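{- Let $A\in\mathbb{Z}^{m\times s}$ be a saturated matrix of rank $s-1$. Assume that, up to sign, $A$ has a unique minimal linear dependency $\mathbf{a}\in\ker_{\mathbb{Z}}A$, that $\sum_{j=1}^s\mathbf{a}_j$ is even, and that $|\mathbf{a}_j|>1$ for some $1\le j\le s$. Then $\mathcal{P}_A$ does not have any regular triangulation (with vertices among its lattice points) that is unimodular with respect to the lattice $\operatorname{aff}(\mathcal{P}_A)\cap\mathbb{Z}^m$.
   Context: $\mathcal{P}_A=\operatorname{conv}$ of the columns of $A$ and $-A$. $A$ is saturated if every lattice point of $\mathcal{P}_A$ other than the origin occurs exactly once as a column of $[A\,|\,-A]$. A minimal linear dependency is a nonzero $\mathbf{a}\in\ker_{\mathbb{Z}}A$ such that no other $\mathbf{a}'\in\ker_{\mathbb{Z}}A$ has the same sign pattern with $|\mathbf{a}'_i|\le|\mathbf{a}_i|$ for all $i$. A triangulation of a lattice polytope is regular if it is induced by a height function on its vertices (maximal simplices are projections of lower faces of the lifted polytope). A $D$-dimensional simplex with vertices in the lattice $L=\operatorname{aff}(P)\cap\mathbb{Z}^m$ ($D=\dim P$) is unimodular with respect to $L$ if its Euclidean volume equals $|\det L|/D!$, where $\det L$ is the determinant of a lattice basis of $L$; a triangulation is unimodular w.r.t. $L$ if all its maximal simplices are. -}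

module Defs where

open import Data.Nat as ℕ using (ℕ; zero; suc)
open import Data.Integer as ℤ using (ℤ; +_)
open import Data.Rational as ℚ using (ℚ; 0ℚ; 1ℚ)
open import Data.Fin using (Fin; zero; suc; splitAt; punchIn)
open import Data.Sum using (_⊎_; [_,_])
open import Data.Product using (Σ; ∃; _×_; _,_)
open import Data.Empty using (⊥)
open import Relation.Nullary using (¬_)
open import Relation.Binary.PropositionalEquality using (_≡_; _≗_)
open import Function.Definitions using (Injective)

-- Basic vocabulary.  Vectors in ℤ^m / ℚ^m are functions Fin m → _,
-- compared pointwise (_≗_).  A matrix A ∈ ℤ^{m×s} is Fin m → Fin s → ℤ.

Pt : ℕ → Set
Pt m = Fin m → ℤ

Ptℚ : ℕ → Set
Ptℚ m = Fin m → ℚ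

Mat : ℕ → ℕ → Set
Mat m s = Fin m → Fin s → ℤ

Σℤ : ∀ {n} → (Fin n → ℤ) → ℤ
Σℤ {zero}  f = + 0
Σℤ {suc n} f = f zero ℤ.+ Σℤ (λ i → f (suc i))

Σℚ : ∀ {n} → (Fin n → ℚ) → ℚ
Σℚ {zero}  f = 0ℚ
Σℚ {suc n} f = f zero ℚ.+ Σℚ (λ i → f (suc i))

toℚ : ∀ {m} → Pt m → Ptℚ m
toℚ x r = x r ℚ./ 1

zeroPt : ∀ {m} → Pt m
zeroPt _ = + 0

sgn : ℤ → ℤ
sgn (+ zero)  = + 0
sgn (+ suc _) = + 1
sgn ℤ.-[1+ _ ] = ℤ.-[1+ 0 ]

det : ∀ {n} → (Fin n → Fin n → ℤ) → ℤ
det {zero}  M = + 1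
det {suc n} M = Σℤ (λ j → alt j ℤ.* (M zero j ℤ.* det (λ i k → M (suc i) (punchIn j k))))
  where
  alt : ∀ {k} → Fin k → ℤ
  alt zero    = + 1
  alt (suc j) = ℤ.- alt j

-- Gram determinant det(⟨e_i,e_j⟩) of a family of vectors in ℤ^m
-- (= (D! · D-dimensional Euclidean volume of the simplex spanned)^2 ).
gramDet : ∀ {m D} → (Fin D → Pt m) → ℤ
gramDet e = det (λ i j → Σℤ (λ r → e i r ℤ.* e j r))

cols± : ∀ {m s} → Mat m s → Fin (s ℕ.+ s) → Pt m
cols± {s = s} A k = [ (λ j r → A r j) , (λ j r → ℤ.- A r j) ] (splitAt s k)

InConv : ∀ {m k} → (Fin k → Pt m) → Ptℚ m → Set
InConv v x = ∃ λ (λ' : Fin _ → ℚ) → (∀ i → 0ℚ ℚ.≤ λ' i) × (Σℚ λ' ≡ 1ℚ)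
  × (∀ r → Σℚ (λ i → λ' i ℚ.* (v i r ℚ./ 1)) ≡ x r)

InConvSub : ∀ {m k} → (Fin k → Pt m) → (Fin k → Set) → Ptℚ m → Set
InConvSub v Q x = ∃ λ (λ' : Fin _ → ℚ) → (∀ i → 0ℚ ℚ.≤ λ' i) × (Σℚ λ' ≡ 1ℚ)
  × (∀ i → ¬ (λ' i ≡ 0ℚ) → Q i)
  × (∀ r → Σℚ (λ i → λ' i ℚ.* (v i r ℚ./ 1)) ≡ x r)

InAff : ∀ {m k} → (Fin k → Pt m) → Ptℚ m → Set
InAff v x = ∃ λ (μ : Fin _ → ℚ) → (Σℚ μ ≡ 1ℚ)
  × (∀ r → Σℚ (λ i → μ i ℚ.* (v i r ℚ./ 1)) ≡ x r)

LatticePt : ∀ {m s} → Mat m s → Pt m → Set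
LatticePt A x = InConv (cols± A) (toℚ x)

Saturated : ∀ {m s} → Mat m s → Set
Saturated A = ∀ x → ¬ (x ≗ zeroPt) → LatticePt A x →
  (∃ λ k → cols± A k ≗ x) × (∀ k k' → cols± A k ≗ x → cols± A k' ≗ x → k ≡ k')

-- columns f(0..r-1) of A are linearly independent (over ℤ, equiv. over ℚ)
ColsIndep : ∀ {m s r} → Mat m s → (Fin r → Fin s) → Set
ColsIndep {r = r} A f = ∀ (c : Fin r → ℤ) → (∀ row → Σℤ (λ i → c i ℤ.* A row (f i)) ≡ + 0) → ∀ i → c i ≡ + 0

HasRank : ∀ {m s} → Mat m s → ℕ → Set
HasRank {s = s} A r =
  (∃ λ (f : Fin r → Fin s) → Injective _≡_ _≡_ f × ColsIndep A f)
  × ¬ (∃ λ (f : Fin (suc r) → Fin s) → Injective _≡_ _≡_ f × ColsIndep A f)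

InKer : ∀ {m s} → Mat m s → (Fin s → ℤ) → Set
InKer A a = ∀ r → Σℤ (λ j → A r j ℤ.* a j) ≡ + 0

MinDep : ∀ {m s} → Mat m s → (Fin s → ℤ) → Set
MinDep A a = InKer A a × ¬ (a ≗ (λ _ → + 0))
  × (∀ a' → InKer A a' → (∀ i → sgn (a' i) ≡ sgn (a i))
           → (∀ i → ℤ.∣ a' i ∣ ℕ.≤ ℤ.∣ a i ∣) → a' ≗ a)

InL : ∀ {m s} → Mat m s → Pt m → Set
InL A x = InAff (cols± A) (toℚ x)

IsBasisL : ∀ {m s} → Mat m s → (D : ℕ) → (Fin D → Pt m) → Set
IsBasisL A D b = (∀ i → InL A (b i))
  × (∀ x → InL A x → ∃ λ (c : Fin D → ℤ) → ∀ r → Σℤ (λ i → c i ℤ.* b i r) ≡ x r)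
  × (∀ (c : Fin D → ℤ) → (∀ r → Σℤ (λ i → c i ℤ.* b i r) ≡ + 0) → ∀ i → c i ≡ + 0)

edges : ∀ {m D} → (Fin (suc D) → Pt m) → Fin D → Pt m
edges σ i r = σ (suc i) r ℤ.- σ zero r

-- A regular triangulation of P_A with lattice-point vertices that is
-- unimodular w.r.t. L.  D is dim P_A (= rank of the lattice L, witnessed
-- by a basis b of L of size D); T lists the t maximal simplices.

RegUnimodTriang : ∀ {m s} → Mat m s → Set
RegUnimodTriang {m} A =
  ∃ λ (D : ℕ) → ∃ λ (b : Fin D → Pt m) → IsBasisL A D b ×
  ∃ λ (t : ℕ) → ∃ λ (T : Fin t → Fin (suc D) → Pt m) →
    (∀ k i → LatticePt A (T k i))
  × (∀ x → InConv (cols± A) x → ∃ λ k → InConv (T k) x)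
  × (∀ k l x → InConv (T k) x → InConv (T l) x →
       InConvSub (T k) (λ i → ∃ λ j → T l j ≗ T k i) x)
    -- unimodular: vol(T k) = |det L| / D!   (compared via squares)
  × (∀ k → gramDet (edges (T k)) ≡ gramDet b)
  × (∃ λ (ω : Pt m → ℚ) → (∀ x y → x ≗ y → ω x ≡ ω y) ×
       (∀ k → ∃ λ (c : Ptℚ m) → ∃ λ (d : ℚ) →
          let ℓ : Pt m → ℚ
              ℓ x = Σℚ (λ r → c r ℚ.* (x r ℚ./ 1)) ℚ.+ d
          in (∀ i → ℓ (T k i) ≡ ω (T k i))
           × (∀ l j → (∀ i → ¬ (T l j ≗ T k i)) → ℓ (T l j) ℚ.< ω (T l j))))

{-# OPTIONS --safe #-}
-- The edges of a unimodular simplex form a basis of the lattice L. Since the entries of a have even sum, the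
-- lattice generated by the columns maps to ℤ/2 with every column going to 1; a simplex avoiding the origin has
-- all its edges in the kernel, so every simplex of the triangulation has the origin as a vertex. Its other
-- vertices are independent columns up to sign, so some column A_i is not used, and expressing A_i through the
-- edges forces |a_i| = 1.
--
-- Let M = |a_j| ≥ 2 be the largest entry, and choose signs η_l for l ≠ j greedily so that σ = Σ η_l a_l satisfies
-- |σ| ≤ M. The functional y with y(A_l) = η_l and y(A_j) = -σ / a_j supports P at the barycentre x of the points
-- η_l A_l. In a simplex containing x and avoiding ± A_i, the coordinates of x differ from the barycentric ones by
-- a multiple t a of the dependency. Since y(x) = 1 is maximal, all coordinates have the sign prescribed by y; as
-- |a_i| = 1 fixes |t|, this is impossible at an index m with η_m a_m = σ, |σ| = M, which the greedy choice provides.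
module Submission where

open import Defs
open import Data.Nat as ℕ using (ℕ; zero; suc; _∸_; _<_)
import Data.Nat.Properties as ℕ
open import Data.Integer as ℤ using (ℤ; +_; -_; _+_; _*_; _-_; ∣_∣)
open import Data.Integer.Properties hiding (_≟_)
open import Data.Integer.Divisibility using (_∣_)
open import Data.Integer.Divisibility.Signed as Signed using (divides; ∣ᵤ⇒∣)
open import Data.Integer.DivMod using (a≡a%n+[a/n]*n; n%d<d)
open import Data.Integer.Tactic.RingSolver using (solve-∀)
import Data.Sign as Sign
open import Data.Rational as ℚ using (ℚ; 0ℚ; 1ℚ)
import Data.Rational.Properties as ℚ
open import Data.Rational.Unnormalised as ℚᵘ using (mkℚᵘ)
import Data.Rational.Unnormalised.Properties as ℚᵘ
open import Data.Fin using (Fin; zero; suc; punchIn; punchOut; toℕ; splitAt)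
open import Data.Fin.Properties using (_≟_; any?; all?; ¬∀⟶∃¬; injective⇒≤; punchIn-injective; punchIn-punchOut; punchInᵢ≢i; punchOut-injective)
open import Data.Vec.Functional using (insertAt)
open import Data.Vec.Functional.Properties using (insertAt-lookup; insertAt-punchIn)
open import Data.Product using (∃; _×_; _,_; proj₁; proj₂)
open import Data.Sum as Sum using (_⊎_; inj₁; inj₂; [_,_]′)
open import Data.Unit using (⊤; tt)
open import Data.Empty using (⊥; ⊥-elim)
open import Function using (_∘_; id)
open import Function.Definitions using (Injective)
open import Relation.Nullary using (¬_; Dec; yes; no)
open import Relation.Nullary.Decidable using (decidable-stable; ¬?)
open import Relation.Binary.PropositionalEquality

-- Finite sums

Σ-cong : ∀ {n} {f g : Fin n → ℤ} → f ≗ g → Σℤ f ≡ Σℤ g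
Σ-cong {zero} h = refl
Σ-cong {suc n} h = cong₂ _+_ (h zero) (Σ-cong (λ i → h (suc i)))

Σ-zero : ∀ {n} {f : Fin n → ℤ} → (∀ i → f i ≡ + 0) → Σℤ f ≡ + 0
Σ-zero {zero} h = refl
Σ-zero {suc n} h rewrite h zero | Σ-zero (λ i → h (suc i)) = refl

Σ-+ : ∀ {n} (f g : Fin n → ℤ) → Σℤ (λ i → f i + g i) ≡ Σℤ f + Σℤ g
Σ-+ {zero} f g = refl
Σ-+ {suc n} f g rewrite Σ-+ (f ∘ suc) (g ∘ suc) = lem (f zero) (g zero) _ _
  where
  lem : ∀ a b c d → (a + b) + (c + d) ≡ (a + c) + (b + d)
  lem = solve-∀

Σ-*ˡ : ∀ {n} c (f : Fin n → ℤ) → Σℤ (λ i → c * f i) ≡ c * Σℤ f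
Σ-*ˡ {zero} c f = sym (*-zeroʳ c)
Σ-*ˡ {suc n} c f rewrite Σ-*ˡ c (f ∘ suc) = sym (*-distribˡ-+ c _ _)

Σ-*ʳ : ∀ {n} c (f : Fin n → ℤ) → Σℤ (λ i → f i * c) ≡ Σℤ f * c
Σ-*ʳ c f = trans (Σ-cong (λ i → *-comm (f i) c)) (trans (Σ-*ˡ c f) (*-comm c _))

Σ-linear : ∀ {n} x y (f g : Fin n → ℤ) → Σℤ (λ i → x * f i + y * g i) ≡ x * Σℤ f + y * Σℤ g
Σ-linear x y f g = trans (Σ-+ (λ i → x * f i) (λ i → y * g i)) (cong₂ _+_ (Σ-*ˡ x f) (Σ-*ˡ y g))

Σ-swap : ∀ {n k} (f : Fin n → Fin k → ℤ) → Σℤ (λ i → Σℤ (f i)) ≡ Σℤ (λ j → Σℤ (λ i → f i j))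
Σ-swap {zero} {k} f = sym (Σ-zero {k} (λ _ → refl))
Σ-swap {suc n} f = trans (cong (_+_ (Σℤ (f zero))) (Σ-swap (f ∘ suc))) (sym (Σ-+ (f zero) _))

Σ-punch : ∀ {n} (j : Fin (suc n)) (f : Fin (suc n) → ℤ) → Σℤ f ≡ f j + Σℤ (f ∘ punchIn j)
Σ-punch zero f = refl
Σ-punch {suc n} (suc j) f = trans (cong (_+_ (f zero)) (Σ-punch j (f ∘ suc))) (lem (f zero) (f (suc j)) _)
  where
  lem : ∀ a b c → a + (b + c) ≡ b + (a + c)
  lem = solve-∀

δ : ∀ {n} → Fin n → Fin n → ℤ
δ zero zero = + 1
δ zero (suc _) = + 0
δ (suc _) zero = + 0
δ (suc i) (suc j) = δ i j

δ-refl : ∀ {n} (i : Fin n) → δ i i ≡ + 1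
δ-refl zero = refl
δ-refl (suc i) = δ-refl i

δ-≢ : ∀ {n} {i j : Fin n} → i ≢ j → δ i j ≡ + 0
δ-≢ {i = zero} {zero} h = ⊥-elim (h refl)
δ-≢ {i = zero} {suc j} h = refl
δ-≢ {i = suc i} {zero} h = refl
δ-≢ {i = suc i} {suc j} h = δ-≢ (h ∘ cong suc)

δ-sym : ∀ {n} (i j : Fin n) → δ i j ≡ δ j i
δ-sym zero zero = refl
δ-sym zero (suc j) = refl
δ-sym (suc i) zero = refl
δ-sym (suc i) (suc j) = δ-sym i j

Σ-δ : ∀ {n} (i : Fin n) (f : Fin n → ℤ) → Σℤ (λ j → δ i j * f j) ≡ f i
Σ-δ zero f = trans (cong₂ _+_ (*-identityˡ (f zero)) (Σ-zero (λ j → *-zeroˡ (f (suc j))))) (+-identityʳ _)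
Σ-δ (suc i) f = trans (cong₂ _+_ (*-zeroˡ (f zero)) (Σ-δ i (f ∘ suc))) (+-identityˡ _)

Σ-single : ∀ {n} (i : Fin n) (f : Fin n → ℤ) → (∀ j → j ≢ i → f j ≡ + 0) → Σℤ f ≡ f i
Σ-single {suc n} i f h = trans (Σ-punch i f)
  (trans (cong (_+_ (f i)) (Σ-zero (λ j → h (punchIn i j) (punchInᵢ≢i i j)))) (+-identityʳ _))

Σ-pair : ∀ {n} {i k : Fin n} (f : Fin n → ℤ) → i ≢ k → (∀ j → j ≢ i → j ≢ k → f j ≡ + 0) → Σℤ f ≡ f i + f k
Σ-pair {suc n} {i} {k} f i≢k h = trans (Σ-punch i f) (cong (_+_ (f i))
  (trans (Σ-single (punchOut i≢k) (f ∘ punchIn i) λ j j≢ → h _ (punchInᵢ≢i i j)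
     λ e → j≢ (punchIn-injective i j _ (trans e (sym (punchIn-punchOut i≢k)))))
   (cong f (punchIn-punchOut i≢k))))

Σ-δʳ : ∀ {n} (i : Fin n) (f : Fin n → ℤ) → Σℤ (λ j → f j * δ j i) ≡ f i
Σ-δʳ i f = trans (Σ-cong (λ j → trans (*-comm (f j) (δ j i)) (cong (_* f j) (δ-sym j i)))) (Σ-δ i f)

-- Determinants

alt : ∀ {k} → Fin k → ℤ
alt zero = + 1
alt (suc j) = - alt j

minor : ∀ {n} → Fin (suc n) → (Fin (suc n) → Fin (suc n) → ℤ) → Fin n → Fin n → ℤ
minor j M i k = M (suc i) (punchIn j k)

-- The sign function inside det is local to its definition and cannot be named. It is reached through
-- unification: the left-hand sides `_` below are solved by the expansion of det from size n + 2 on, where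
-- abstracting over suc n separates the size of the matrix from that of the index, so that induction applies.
mutual
  det-laplace : ∀ {n} (M : Fin (suc n) → Fin (suc n) → ℤ) →
    det M ≡ Σℤ (λ j → alt j * (M zero j * det (minor j M)))
  det-laplace {zero} M = refl
  det-laplace {suc n} M = cong (λ y → summand zero + (summand (suc zero) + y)) (Σ-cong (later-term n M))
    where
    summand : Fin (suc (suc n)) → ℤ
    summand j = alt j * (M zero j * det (minor j M))

  later-term : ∀ n (M : Fin (suc (suc n)) → Fin (suc (suc n)) → ℤ) (i : Fin n) →
    _ ≡ alt (suc (suc i)) * (M zero (suc (suc i)) * det (minor (suc (suc i)) M))
  later-term n M i with M zero (suc (suc i)) * det (minor (suc (suc i)) M)
  ... | x = sign-times n M i x

  sign-times : ∀ n (M : Fin (suc (suc n)) → Fin (suc (suc n)) → ℤ) (i : Fin n) x → _ ≡ alt (suc (suc i)) * x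
  sign-times n M i x with -_ | ℤ._◃_ | ℤ.sign | ℤ.∣_∣ | Sign._*_ | ℕ._*_
  ... | neg | _◃_ | sg | ab | _·_ | _×_ =
    cong (λ y → (sg (neg (neg y)) · sg x) ◃ (ab (neg (neg y)) × ab x)) (sign-of n M i)

  sign-of : ∀ n (M : Fin (suc (suc n)) → Fin (suc (suc n)) → ℤ) (i : Fin n) → _ ≡ alt i
  sign-of n M i with suc n | M
  ... | N | M' = sign-of′ N M' n i

  sign-of′ : ∀ n (M : Fin (suc n) → Fin (suc n) → ℤ) k (i : Fin k) → _ ≡ alt i
  sign-of′ n M (suc k) zero = refl
  sign-of′ n M (suc k) (suc i) = cong -_ (sign-of′ n M k i)

-- Alternating multilinear forms

infixr 5 _∷ᶠ_
_∷ᶠ_ : ∀ {n} {X : Set} → X → (Fin n → X) → Fin (suc n) → X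
(x ∷ᶠ e) zero = x
(x ∷ᶠ e) (suc i) = e i

-- The dimension m is kept apart from the number n of arguments, because fixing one argument lowers
-- n alone. `vanish` asks only for equal neighbours, the case that a Laplace expansion settles
-- directly.
record Alternating {m} n (G : (Fin n → Pt m) → ℤ) : Set where
  field
    respects : ∀ {e e'} → (∀ i → e i ≗ e' i) → G e ≡ G e'
    linear : ∀ i x y {e e' e''} → (∀ k → k ≢ i → e k ≗ e' k) → (∀ k → k ≢ i → e k ≗ e'' k)
      → (∀ r → e i r ≡ x * e' i r + y * e'' i r) → G e ≡ x * G e' + y * G e''
    vanish : ∀ i k {e} → toℕ k ≡ suc (toℕ i) → e i ≗ e k → G e ≡ + 0

open Alternating

Alternating-≗ : ∀ {m n} {G H : (Fin n → Pt m) → ℤ} → G ≗ H → Alternating n G → Alternating n H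
Alternating-≗ G≗H AG = record
  { respects = λ {e} {e'} h → trans (sym (G≗H e)) (trans (respects AG h) (G≗H e'))
  ; linear = λ i x y {e} {e'} {e''} h' h'' h → trans (sym (G≗H e)) (trans (linear AG i x y h' h'' h)
      (cong₂ (λ p q → x * p + y * q) (G≗H e') (G≗H e'')))
  ; vanish = λ i k {e} ik h → trans (sym (G≗H e)) (vanish AG i k ik h) }

det-cong : ∀ {n} {M N : Fin n → Fin n → ℤ} → (∀ i j → M i j ≡ N i j) → det M ≡ det N
det-cong {zero} h = refl
det-cong {suc n} {M} {N} h = trans (det-laplace M) (trans
  (Σ-cong (λ j → cong₂ (λ p q → alt j * (p * q)) (h zero j) (det-cong λ i k → h (suc i) (punchIn j k))))
  (sym (det-laplace N)))

transpose : ∀ {n} → (Fin n → Fin n → ℤ) → Fin n → Fin n → ℤ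
transpose M i j = M j i

alt-next : ∀ {n} (i k : Fin n) → toℕ k ≡ suc (toℕ i) → alt k ≡ - alt i
alt-next zero (suc zero) e = refl
alt-next (suc i) (suc k) e = cong -_ (alt-next i k (cong ℕ.pred e))

-- Deleting i or its neighbour k leaves two lists of columns that differ in at most one place, where
-- one has k and the other i. If columns i and k are equal, the two minors therefore coincide.
punchIn-next : ∀ {n} (i k : Fin (suc n)) → toℕ k ≡ suc (toℕ i) → ∀ c →
  punchIn i c ≡ punchIn k c ⊎ (punchIn i c ≡ k × punchIn k c ≡ i)
punchIn-next zero (suc zero) e zero = inj₂ (refl , refl)
punchIn-next zero (suc zero) e (suc c) = inj₁ refl
punchIn-next (suc i) (suc k) e zero = inj₁ refl
punchIn-next (suc i) (suc k) e (suc c) with punchIn-next i k (cong ℕ.pred e) c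
... | inj₁ h = inj₁ (cong suc h)
... | inj₂ (h , h') = inj₂ (cong suc h , cong suc h')

-- Lets equal neighbouring columns be passed on to the minor that deletes a third column.
punchOut-next : ∀ {n} (j i k : Fin (suc n)) → toℕ k ≡ suc (toℕ i) → j ≢ i → j ≢ k →
  ∃ λ i' → ∃ λ k' → punchIn j i' ≡ i × punchIn j k' ≡ k × toℕ k' ≡ suc (toℕ i')
punchOut-next zero zero k e j≢i j≢k = ⊥-elim (j≢i refl)
punchOut-next zero (suc i) (suc k) e j≢i j≢k = i , k , refl , refl , cong ℕ.pred e
punchOut-next (suc zero) zero (suc zero) e j≢i j≢k = ⊥-elim (j≢k refl)
punchOut-next {suc (suc n)} (suc (suc j)) zero (suc zero) e j≢i j≢k = zero , suc zero , refl , refl , refl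
punchOut-next {suc n} (suc j) (suc i) (suc k) e j≢i j≢k
  with i' , k' , p , q , r ← punchOut-next j i k (cong ℕ.pred e) (j≢i ∘ cong suc) (j≢k ∘ cong suc)
  = suc i' , suc k' , cong suc p , cong suc q , cong suc r

-- Induction along the expansion in the first row: the varying column enters a summand through its
-- entry if it is the deleted column, and through the minor otherwise.
det-columns : ∀ n → Alternating n (det ∘ transpose {n})
det-columns zero = record { respects = λ _ → refl ; linear = λ () ; vanish = λ () }
det-columns (suc n) = record { respects = λ h → det-cong (λ i j → h j i) ; linear = lin ; vanish = van }
  where
  IH = det-columns n

  lin : ∀ i x y {e e' e''} → (∀ k → k ≢ i → e k ≗ e' k) → (∀ k → k ≢ i → e k ≗ e'' k)
      → (∀ r → e i r ≡ x * e' i r + y * e'' i r)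
      → det (transpose e) ≡ x * det (transpose e') + y * det (transpose e'')
  lin i x y {e} {e'} {e''} h' h'' h = trans (det-laplace (transpose e)) (trans (Σ-cong summand)
    (trans (Σ-linear x y (term e') (term e''))
      (sym (cong₂ (λ p q → x * p + y * q) (det-laplace (transpose e')) (det-laplace (transpose e''))))))
    where
    term : (Fin (suc n) → Pt (suc n)) → Fin (suc n) → ℤ
    term e j = alt j * (e j zero * det (minor j (transpose e)))
    at-i : ∀ x y s a b d → s * ((x * a + y * b) * d) ≡ x * (s * (a * d)) + y * (s * (b * d))
    at-i = solve-∀
    off-i : ∀ x y s a b d → s * (a * (x * b + y * d)) ≡ x * (s * (a * b)) + y * (s * (a * d))
    off-i = solve-∀
    summand : ∀ j → term e j ≡ x * term e' j + y * term e'' j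
    summand j with j ≟ i
    ... | yes refl = trans (cong (λ p → alt j * (p * D)) (h zero))
          (trans (at-i x y (alt j) (e' j zero) (e'' j zero) D)
            (cong₂ (λ p q → x * (alt j * (e' j zero * p)) + y * (alt j * (e'' j zero * q)))
              (det-cong λ r k → h' (punchIn j k) (punchInᵢ≢i j k) (suc r))
              (det-cong λ r k → h'' (punchIn j k) (punchInᵢ≢i j k) (suc r))))
      where D = det (minor j (transpose e))
    ... | no j≢i = trans (cong (λ p → alt j * (e j zero * p)) (linear IH i' x y
              {λ k r → e (punchIn j k) (suc r)} {λ k r → e' (punchIn j k) (suc r)} {λ k r → e'' (punchIn j k) (suc r)}
              (λ k k≢ r → h' (punchIn j k) (avoid k k≢) (suc r))
              (λ k k≢ r → h'' (punchIn j k) (avoid k k≢) (suc r))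
              (λ r → subst (λ c → e c (suc r) ≡ x * e' c (suc r) + y * e'' c (suc r)) (sym (punchIn-punchOut j≢i)) (h (suc r)))))
          (trans (off-i x y (alt j) (e j zero) _ _)
            (cong₂ (λ p q → x * (alt j * (p * det (minor j (transpose e')))) + y * (alt j * (q * det (minor j (transpose e'')))))
              (h' j j≢i zero) (h'' j j≢i zero)))
      where
      i' = punchOut j≢i
      avoid : ∀ k → k ≢ i' → punchIn j k ≢ i
      avoid k k≢ p = k≢ (punchIn-injective j k i' (trans p (sym (punchIn-punchOut j≢i))))

  van : ∀ i k {e} → toℕ k ≡ suc (toℕ i) → e i ≗ e k → det (transpose e) ≡ + 0
  -- Only the summands that delete i or k survive; their minors agree and their signs are opposite.
  van i k {e} ik h = trans (det-laplace (transpose e)) (trans (Σ-pair summand i≢k others) cancel)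
    where
    summand : Fin (suc n) → ℤ
    summand j = alt j * (e j zero * det (minor j (transpose e)))
    i≢k : i ≢ k
    i≢k refl = ℕ.1+n≢n (sym ik)
    others : ∀ j → j ≢ i → j ≢ k → summand j ≡ + 0
    others j j≢i j≢k with i' , k' , p , q , r ← punchOut-next j i k ik j≢i j≢k =
      trans (cong (λ d → alt j * (e j zero * d)) (vanish IH i' k' {λ c r → e (punchIn j c) (suc r)} r
        (λ r → trans (cong (λ c → e c (suc r)) p) (trans (h (suc r)) (cong (λ c → e c (suc r)) (sym q))))))
        (trans (cong (alt j *_) (*-zeroʳ (e j zero))) (*-zeroʳ (alt j)))
    minors : det (minor i (transpose e)) ≡ det (minor k (transpose e))
    minors = det-cong λ r c → same-column r c (punchIn-next i k ik c)
      where
      same-column : ∀ r c → punchIn i c ≡ punchIn k c ⊎ (punchIn i c ≡ k × punchIn k c ≡ i) →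
        e (punchIn i c) (suc r) ≡ e (punchIn k c) (suc r)
      same-column r c (inj₁ p) = cong (λ c → e c (suc r)) p
      same-column r c (inj₂ (p , q)) = trans (cong (λ c → e c (suc r)) p) (trans (sym (h (suc r))) (cong (λ c → e c (suc r)) (sym q)))
    cancel : summand i + summand k ≡ + 0
    cancel = trans (cong₂ (λ p q → alt i * (p * q) + summand k) (h zero) minors)
      (trans (cong (λ s → alt i * (e k zero * D) + s * (e k zero * D)) (alt-next i k ik)) (lem (alt i) (e k zero * D)))
      where
      D = det (minor k (transpose e))
      lem : ∀ s t → s * t + (- s) * t ≡ + 0
      lem = solve-∀

module _ {m n} {G : (Fin (suc n) → Pt m) → ℤ} (AG : Alternating (suc n) G) where

  tail-alternating : ∀ u → Alternating n (λ e → G (u ∷ᶠ e))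
  tail-alternating u = record
    { respects = λ h → respects AG λ { zero _ → refl ; (suc i) → h i }
    ; linear = λ i x y h' h'' h → linear AG (suc i) x y
        (λ { zero _ _ → refl ; (suc k) k≢ → h' k (k≢ ∘ cong suc) })
        (λ { zero _ _ → refl ; (suc k) k≢ → h'' k (k≢ ∘ cong suc) }) h
    ; vanish = λ i k ik h → vanish AG (suc i) (suc k) (cong suc ik) h }

  linear₀ : ∀ x y {u v w e} → (∀ r → u r ≡ x * v r + y * w r) → G (u ∷ᶠ e) ≡ x * G (v ∷ᶠ e) + y * G (w ∷ᶠ e)
  linear₀ x y = linear AG zero x y
    (λ { zero k≢ → ⊥-elim (k≢ refl) ; (suc k) _ _ → refl })
    (λ { zero k≢ → ⊥-elim (k≢ refl) ; (suc k) _ _ → refl })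

  Σ-linear₀ : ∀ {k} (c : Fin k → ℤ) (v : Fin k → Pt m) e →
    G ((λ r → Σℤ (λ j → c j * v j r)) ∷ᶠ e) ≡ Σℤ (λ j → c j * G (v j ∷ᶠ e))
  Σ-linear₀ {zero} c v e = linear₀ (+ 0) (+ 0) {v = λ _ → + 0} {w = λ _ → + 0} λ _ → refl
  Σ-linear₀ {suc k} c v e = trans
    (linear₀ (c zero) (+ 1) {v = v zero} {w = λ r → Σℤ (λ j → c (suc j) * v (suc j) r)}
      (λ r → cong (_+_ (c zero * v zero r)) (sym (*-identityˡ _))))
    (cong (_+_ (c zero * G (v zero ∷ᶠ e))) (trans (*-identityˡ _) (Σ-linear₀ (c ∘ suc) (v ∘ suc) e)))

-- Polarisation: G vanishes with u + v in both leading places, and expanding leaves the two mixed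
-- terms.
swap₀₁ : ∀ {m n} {G : (Fin (suc (suc n)) → Pt m) → ℤ} → Alternating (suc (suc n)) G → ∀ u v e →
  G (u ∷ᶠ v ∷ᶠ e) ≡ - G (v ∷ᶠ u ∷ᶠ e)
swap₀₁ {m} {n} {G} AG u v e = neg-unique (trans (sym expand) (vanish AG zero (suc zero) refl λ _ → refl))
  where
  s : Pt m
  s r = + 1 * u r + + 1 * v r
  neg-unique : ∀ {a b} → + 1 * (+ 1 * + 0 + + 1 * a) + + 1 * (+ 1 * b + + 1 * + 0) ≡ + 0 → a ≡ - b
  neg-unique {a} {b} h = trans (lem₁ a b) (trans (cong (_- b) h) (+-identityˡ _))
    where
    lem₁ : ∀ a b → a ≡ (+ 1 * (+ 1 * + 0 + + 1 * a) + + 1 * (+ 1 * b + + 1 * + 0)) - b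
    lem₁ = solve-∀
  expand : G (s ∷ᶠ s ∷ᶠ e) ≡ + 1 * (+ 1 * + 0 + + 1 * G (u ∷ᶠ v ∷ᶠ e)) + + 1 * (+ 1 * G (v ∷ᶠ u ∷ᶠ e) + + 1 * + 0)
  expand = trans (linear₀ AG (+ 1) (+ 1) {v = u} {w = v} λ _ → refl)
    (cong₂ (λ p q → + 1 * p + + 1 * q)
      (trans (linear₀ (tail-alternating AG u) (+ 1) (+ 1) {v = u} {w = v} λ _ → refl)
        (cong (λ p → + 1 * p + + 1 * G (u ∷ᶠ v ∷ᶠ e)) (vanish AG zero (suc zero) refl λ _ → refl)))
      (trans (linear₀ (tail-alternating AG v) (+ 1) (+ 1) {v = u} {w = v} λ _ → refl)
        (cong (λ p → + 1 * G (v ∷ᶠ u ∷ᶠ e) + + 1 * p) (vanish AG zero (suc zero) refl λ _ → refl))))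

∷ᶠ-η : ∀ {m n} (e : Fin (suc n) → Pt m) i → e i ≗ (e zero ∷ᶠ (e ∘ suc)) i
∷ᶠ-η e zero _ = refl
∷ᶠ-η e (suc i) _ = refl

-- Swapping the first two arguments carries u one place closer to its copy, until they are
-- neighbours.
vanish₀ : ∀ {m n} {G : (Fin (suc n) → Pt m) → ℤ} → Alternating (suc n) G → ∀ u e i → e i ≗ u → G (u ∷ᶠ e) ≡ + 0
vanish₀ AG u e zero h = vanish AG zero (suc zero) refl (sym ∘ h)
vanish₀ AG u e (suc i) h = trans (respects AG λ { zero _ → refl ; (suc i) → ∷ᶠ-η e i })
  (trans (swap₀₁ AG u (e zero) (e ∘ suc))
    (cong -_ (vanish₀ (tail-alternating AG (e zero)) u (e ∘ suc) i h)))

-- Row operations with a vector w that stands outside the list: after expansion every term with w as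
-- an entry is zero.
absorb : ∀ {m n} {G : (Fin n → Pt m) → ℤ} → Alternating n G → ∀ w → (∀ e i → e i ≗ w → G e ≡ + 0) →
  ∀ (c : Fin n → ℤ) e → G (λ i r → c i * w r + e i r) ≡ G e
absorb {n = zero} AG w null c e = respects AG λ ()
absorb {m} {suc n} {G} AG w null c e = trans (respects AG (∷ᶠ-η _))
  (trans (linear₀ AG (c zero) (+ 1) {v = w} {w = e zero} (λ r → cong (_+_ (c zero * w r)) (sym (*-identityˡ _))))
  (trans (cong₂ (λ p q → c zero * p + + 1 * q) (null (w ∷ᶠ e') zero λ _ → refl)
     (trans (absorb (tail-alternating AG (e zero)) w (λ e i → null _ (suc i)) (c ∘ suc) (e ∘ suc)) (sym (respects AG (∷ᶠ-η e)))))
  (lem (c zero) (G e))))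
  where
  e' : Fin n → Pt m
  e' i r = c (suc i) * w r + e (suc i) r
  lem : ∀ c g → c * + 0 + + 1 * g ≡ g
  lem = solve-∀

rotate : ∀ {m n} {G : (Fin (suc n) → Pt m) → ℤ} → Alternating (suc n) G → ∀ b j → G (b j ∷ᶠ b ∘ punchIn j) ≡ alt j * G b
rotate {G = G} AG b zero = trans (sym (respects AG (∷ᶠ-η b))) (sym (*-identityˡ _))
rotate {n = suc n} {G} AG b (suc j) =
  trans (respects AG λ { zero _ → refl ; (suc zero) _ → refl ; (suc (suc i)) _ → refl })
  (trans (swap₀₁ AG (b (suc j)) (b zero) (b ∘ suc ∘ punchIn j))
  (trans (cong -_ (rotate (tail-alternating AG (b zero)) (b ∘ suc) j))
  (trans (neg-distribˡ-* (alt j) _) (cong (_*_ (- alt j)) (sym (respects AG (∷ᶠ-η b)))))))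

combine : ∀ {m n k} → (Fin n → Fin k → ℤ) → (Fin k → Pt m) → Fin n → Pt m
combine M b i r = Σℤ (λ k → M i k * b k r)

-- Alternating forms are unique up to a factor. The first row is expanded; in the term of `b j` the
-- other rows lose their multiples of `b j` by `absorb`, so the minor appears by induction, and
-- `rotate` supplies the Laplace sign. Suitable choices of G give invariance under transposition and
-- multiplicativity.
alternating-combine : ∀ {m n} {G : (Fin n → Pt m) → ℤ} → Alternating n G → ∀ M b → G (combine M b) ≡ det M * G b
alternating-combine {n = zero} AG M b = trans (respects AG λ ()) (sym (*-identityˡ _))
alternating-combine {m} {suc n} {G} AG M b =
  trans (respects AG (∷ᶠ-η (combine M b)))
  (trans (Σ-linear₀ AG (M zero) b (combine M b ∘ suc))
  (trans (Σ-cong summand)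
  (trans (Σ-*ʳ (G b) laplace) (cong (_* G b) (sym (det-laplace M))))))
  where
  laplace : Fin (suc n) → ℤ
  laplace j = alt j * (M zero j * det (minor j M))
  lem : ∀ a d s g → a * (d * (s * g)) ≡ (s * (a * d)) * g
  lem = solve-∀
  summand : ∀ j → M zero j * G (b j ∷ᶠ combine M b ∘ suc) ≡ laplace j * G b
  summand j = trans (cong (_*_ (M zero j))
    (trans (respects (tail-alternating AG (b j)) (λ i r → Σ-punch j (λ k → M (suc i) k * b k r)))
    (trans (absorb (tail-alternating AG (b j)) (b j) (vanish₀ AG (b j)) (λ i → M (suc i) j) (combine (minor j M) (b ∘ punchIn j)))
    (trans (alternating-combine (tail-alternating AG (b j)) (minor j M) (b ∘ punchIn j))
      (cong (_*_ (det (minor j M))) (rotate AG b j))))))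
    (lem (M zero j) (det (minor j M)) (alt j) (G b))

det-δ : ∀ n → det (δ {n}) ≡ + 1
det-δ zero = refl
det-δ (suc n) = trans (det-laplace (δ {suc n})) (trans (Σ-single zero (λ j → alt j * (δ {suc n} zero j * det (minor j δ))) λ
    { zero j≢ → ⊥-elim (j≢ refl) ; (suc j) _ → *-zeroʳ (alt (suc j)) })
  (trans (*-identityˡ _) (trans (*-identityˡ _) (det-δ n))))

-- The determinant by columns is itself an alternating form; it is evaluated on the rows of M,
-- written as M times the identity.
det-transpose : ∀ {n} (M : Fin n → Fin n → ℤ) → det (transpose M) ≡ det M
det-transpose {n} M = trans (respects (det-columns n) (λ i r → sym (Σ-δʳ r (M i))))
  (trans (alternating-combine (det-columns n) M δ)
  (trans (cong (_*_ (det M)) (trans (det-cong {n} (λ i j → δ-sym j i)) (det-δ n))) (*-identityʳ _)))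

det-rows : ∀ n → Alternating n (det {n})
det-rows n = Alternating-≗ det-transpose (det-columns n)

det-* : ∀ {n} (M N : Fin n → Fin n → ℤ) → det (combine M N) ≡ det M * det N
det-* {n} = alternating-combine (det-rows n)

-- Gram determinants and unimodular changes of basis

dot : ∀ {m} → Pt m → Pt m → ℤ
dot u v = Σℤ (λ r → u r * v r)

dot-comm : ∀ {m} (u v : Pt m) → dot u v ≡ dot v u
dot-comm u v = Σ-cong (λ r → *-comm (u r) (v r))

dot-Σˡ : ∀ {m k} (c : Fin k → ℤ) (b : Fin k → Pt m) v → dot (λ r → Σℤ (λ i → c i * b i r)) v ≡ Σℤ (λ i → c i * dot (b i) v)
dot-Σˡ c b v = trans (Σ-cong (λ r → sym (Σ-*ʳ (v r) (λ i → c i * b i r))))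
  (trans (Σ-swap (λ r i → c i * b i r * v r))
  (Σ-cong (λ i → trans (Σ-cong (λ r → *-assoc (c i) (b i r) (v r))) (Σ-*ˡ (c i) (λ r → b i r * v r)))))

-- The Gram matrix of the new family is M B Mᵀ, where B is that of b; M is extracted from the rows
-- and, after a transposition, from the columns.
gramDet-combine : ∀ {m n} (M : Fin n → Fin n → ℤ) (b : Fin n → Pt m) → gramDet (combine M b) ≡ det M * (det M * gramDet b)
gramDet-combine {m} {n} M b =
  trans (det-cong (λ i j → dot-Σˡ (M i) b (combine M b j)))
  (trans (det-* M (λ i j → dot (b i) (combine M b j)))
  (cong (_*_ (det M)) (trans (sym (det-transpose (λ i j → dot (b i) (combine M b j))))
  (trans (det-cong (λ i j → trans (dot-comm (b j) (combine M b i)) (dot-Σˡ (M i) b (b j))))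
  (det-* M (λ i j → dot (b i) (b j)))))))

Σ-combine : ∀ {m n k} (c : Fin n → ℤ) (M : Fin n → Fin k → ℤ) (b : Fin k → Pt m) r →
  Σℤ (λ i → c i * combine M b i r) ≡ Σℤ (λ k → Σℤ (λ i → c i * M i k) * b k r)
Σ-combine c M b r = trans (Σ-cong (λ i → trans (sym (Σ-*ˡ (c i) (λ k → M i k * b k r)))
    (Σ-cong (λ k → sym (*-assoc (c i) (M i k) (b k r))))))
  (trans (Σ-swap (λ i k → c i * M i k * b k r)) (Σ-cong (λ k → Σ-*ʳ (b k r) (λ i → c i * M i k))))

abstract
  -- The matrix with columns v and `w i`, with its row r repeated on top, has determinant zero. Its
  -- expansion along the top row is coordinate r of the relation; the coefficients do not depend on
  -- r.
  cramer : ∀ {n} (w : Fin n → Pt n) (v : Pt n) → ∃ λ (c : Fin n → ℤ) → ∀ r → Σℤ (λ i → c i * w i r) ≡ det w * v r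
  cramer {n} w v = (λ j → alt j * D j) , λ r → solve-for (Σℤ (λ j → alt j * D j * w j r)) (det w) (v r) (trans (cong₂ _+_ (head r) (tail r)) (zero-det r))
    where
    rows : Fin n → Pt (suc n)
    rows r j = (v ∷ᶠ w) j r
    D : Fin n → ℤ
    D j = det (λ i k → rows i (punchIn (suc j) k))
    laplace : Fin n → Fin (suc n) → ℤ
    laplace r j = alt j * (rows r j * det (minor j (rows r ∷ᶠ rows)))
    zero-det : ∀ r → Σℤ (laplace r) ≡ + 0
    zero-det r = trans (sym (det-laplace (rows r ∷ᶠ rows))) (vanish₀ (det-rows (suc n)) (rows r) rows r λ _ → refl)
    head : ∀ r → v r * det w ≡ laplace r zero
    head r = trans (cong (_*_ (v r)) (sym (det-transpose w))) (sym (*-identityˡ (v r * det (minor zero (rows r ∷ᶠ rows)))))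
    lem : ∀ s a d → (- + 1) * ((s * d) * a) ≡ (- s) * (a * d)
    lem = solve-∀
    tail : ∀ r → (- + 1) * Σℤ (λ j → alt j * D j * w j r) ≡ Σℤ (laplace r ∘ suc)
    tail r = trans (sym (Σ-*ˡ (- + 1) (λ j → alt j * D j * w j r))) (Σ-cong λ j → lem (alt j) (w j r) (D j))
    solve-for : ∀ s d v → v * d + (- + 1) * s ≡ + 0 → s ≡ d * v
    solve-for s d v h = trans (lem′ s d v) (trans (cong (λ z → d * v - z) h) (+-identityʳ _))
      where
      lem′ : ∀ s d v → s ≡ d * v - (v * d + (- + 1) * s)
      lem′ = solve-∀

  -- Since `det w` is its own inverse, multiplying Cramer's relation by it removes the factor in
  -- front of v.
  rows-span : ∀ {n} (w : Fin n → Pt n) → det w * det w ≡ + 1 → ∀ (v : Pt n) → ∃ λ (c : Fin n → ℤ) → ∀ r → Σℤ (λ i → c i * w i r) ≡ v r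
  rows-span {n} w d² v = scale (cramer w v)
    where
    scale : (∃ λ (c : Fin n → ℤ) → ∀ r → Σℤ (λ i → c i * w i r) ≡ det w * v r) →
      ∃ λ (c : Fin n → ℤ) → ∀ r → Σℤ (λ i → c i * w i r) ≡ v r
    scale (c , h) = (λ i → det w * c i) , λ r →
      trans (Σ-cong (λ i → *-assoc (det w) (c i) (w i r)))
      (trans (Σ-*ˡ (det w) (λ i → c i * w i r))
      (trans (cong (_*_ (det w)) (h r))
      (trans (sym (*-assoc (det w) (det w) (v r))) (trans (cong (_* v r) d²) (*-identityˡ (v r))))))

Σ-exchange : ∀ {n k} (c : Fin n → ℤ) (u : Fin k → ℤ) (M : Fin n → Fin k → ℤ) →
  Σℤ (λ i → c i * Σℤ (λ k → u k * M i k)) ≡ Σℤ (λ k → u k * Σℤ (λ i → c i * M i k))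
Σ-exchange c u M = trans (Σ-cong (λ i → sym (Σ-*ˡ (c i) (λ k → u k * M i k))))
  (trans (Σ-swap (λ i k → c i * (u k * M i k)))
  (Σ-cong (λ k → trans (Σ-cong (λ i → lem (c i) (u k) (M i k))) (Σ-*ˡ (u k) (λ i → c i * M i k)))))
  where
  lem : ∀ c u m → c * (u * m) ≡ u * (c * m)
  lem = solve-∀

Independent : ∀ {m n} → (Fin n → Pt m) → Set
Independent {n = n} b = ∀ (c : Fin n → ℤ) → (∀ r → Σℤ (λ i → c i * b i r) ≡ + 0) → ∀ i → c i ≡ + 0

0≤i*i : ∀ i → + 0 ℤ.≤ i * i
0≤i*i (+ n) = subst (+ 0 ℤ.≤_) (sym (+◃n≡+n (n ℕ.* n))) (ℤ.+≤+ ℕ.z≤n)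
0≤i*i ℤ.-[1+ n ] = ℤ.+≤+ ℕ.z≤n

Σ-mono-≤ : ∀ {n} {f g : Fin n → ℤ} → (∀ i → f i ℤ.≤ g i) → Σℤ f ℤ.≤ Σℤ g
Σ-mono-≤ {zero} h = ≤-refl
Σ-mono-≤ {suc n} h = +-mono-≤ (h zero) (Σ-mono-≤ (h ∘ suc))

Σ-nonneg : ∀ {n} {f : Fin n → ℤ} → (∀ i → + 0 ℤ.≤ f i) → + 0 ℤ.≤ Σℤ f
Σ-nonneg {n} {f} h = subst (ℤ._≤ Σℤ f) (Σ-zero {n} λ _ → refl) (Σ-mono-≤ h)

term≤Σ : ∀ {n} {f : Fin n → ℤ} → (∀ i → + 0 ℤ.≤ f i) → ∀ i → f i ℤ.≤ Σℤ f
term≤Σ {suc n} {f} h i = subst (ℤ._≤ _) (+-identityʳ (f i))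
  (subst (f i + + 0 ℤ.≤_) (sym (Σ-punch i f)) (+-monoʳ-≤ (f i) (Σ-nonneg (h ∘ punchIn i))))

*-cancel-zero : ∀ i {j} → i ≢ + 0 → i * j ≡ + 0 → j ≡ + 0
*-cancel-zero i i≢0 h = [ ⊥-elim ∘ i≢0 , id ]′ (i*j≡0⇒i≡0∨j≡0 i h)

dot-definite : ∀ {m} (u : Pt m) → dot u u ≡ + 0 → ∀ r → u r ≡ + 0
dot-definite u h r = [ id , id ]′ (i*j≡0⇒i≡0∨j≡0 (u r)
  (≤-antisym (subst (u r * u r ℤ.≤_) h (term≤Σ (λ r → 0≤i*i (u r)) r)) (0≤i*i (u r))))

-- A Gram-Schmidt step without division: the vectors g₀ bᵢ - qᵢ b₀ are orthogonal to b₀, so the Gram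
-- determinant of the new family splits as g₀ times a smaller one. If that of b were zero, so would
-- be the smaller one, against the induction hypothesis.
gramDet-independent : ∀ {m n} (b : Fin n → Pt m) → Independent b → gramDet b ≢ + 0
gramDet-independent {n = zero} b ind ()
gramDet-independent {m} {suc n} b ind g≡0 = gramDet-independent b′ ind′ (*-cancel-zero g₀ g₀≢0 (trans (sym split) gram-e))
  where
  g₀ : ℤ
  g₀ = dot (b zero) (b zero)
  q : Fin n → ℤ
  q i = dot (b (suc i)) (b zero)
  M : Fin (suc n) → Fin (suc n) → ℤ
  M = δ zero ∷ᶠ (λ i → - q i ∷ᶠ λ k → g₀ * δ i k)
  e : Fin (suc n) → Pt m
  e = combine M b
  b′ : Fin n → Pt m
  b′ = e ∘ suc

  g₀≢0 : g₀ ≢ + 0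
  g₀≢0 h with () ← trans (sym (δ-refl (zero {n}))) (ind (δ zero) (λ r → trans (Σ-δ zero (λ i → b i r)) (dot-definite (b zero) h r)) zero)

  gram-e : gramDet e ≡ + 0
  gram-e = trans (gramDet-combine M b) (trans (cong (λ g → det M * (det M * g)) g≡0)
    (trans (cong (_*_ (det M)) (*-zeroʳ (det M))) (*-zeroʳ (det M))))

  e₀ : ∀ r → e zero r ≡ b zero r
  e₀ r = Σ-δ zero (λ i → b i r)

  dot-e₀ : ∀ v → dot (e zero) v ≡ dot (b zero) v
  dot-e₀ v = Σ-cong (λ r → cong (_* v r) (e₀ r))

  orthogonal : ∀ i → dot (e zero) (b′ i) ≡ + 0
  orthogonal i = trans (dot-e₀ (b′ i)) (trans (dot-comm (b zero) (b′ i)) (trans (dot-Σˡ (M (suc i)) b (b zero))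
    (trans (cong (_+_ (- q i * g₀)) (trans (Σ-cong (λ k → *-assoc g₀ (δ i k) (q k)))
      (trans (Σ-*ˡ g₀ (λ k → δ i k * q k)) (cong (_*_ g₀) (Σ-δ i q))))) (lem (q i) g₀))))
    where
    lem : ∀ q g → (- q) * g + g * q ≡ + 0
    lem = solve-∀

  split : gramDet e ≡ g₀ * gramDet b′
  split = trans (det-laplace G) (trans (Σ-single zero (λ j → alt j * (G zero j * det (minor j G))) λ
      { zero j≢ → ⊥-elim (j≢ refl)
      ; (suc j) _ → trans (cong (λ z → alt (suc j) * (z * det (minor (suc j) G))) (orthogonal j)) (*-zeroʳ (alt (suc j))) })
    (trans (*-identityˡ _) (cong (_* gramDet b′) (trans (dot-e₀ (e zero)) (trans (dot-comm (b zero) (e zero)) (dot-e₀ (b zero)))))))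
    where
    G : Fin (suc n) → Fin (suc n) → ℤ
    G i j = dot (e i) (e j)

  ind′ : Independent b′
  -- In terms of b, the relation c has coefficient g₀ cᵢ at the vector of index i + 1.
  ind′ c h i = *-cancel-zero g₀ g₀≢0 (trans (*-comm g₀ (c i))
    (trans (sym (trans (Σ-cong (λ l → lem (c l) g₀ (δ l i))) (Σ-δʳ i (λ l → c l * g₀))))
    (ind (λ k → Σℤ (λ l → c l * M (suc l) k)) (λ r → trans (sym (Σ-combine c (M ∘ suc) b r)) (h r)) (suc i))))
    where
    lem : ∀ c g d → c * (g * d) ≡ c * g * d
    lem = solve-∀

module _ {m n} (b : Fin n → Pt m) (ind : Independent b) (M : Fin n → Fin n → ℤ) (vol : gramDet (combine M b) ≡ gramDet b) where

  private
    -- Equal volumes give (det M)² g = g for the Gram determinant g of b, which is nonzero by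
    -- independence. Hence M is invertible over ℤ.
    det²≡1 : det M * det M ≡ + 1
    det²≡1 = cancel (det M) (gramDet b) (gramDet-independent b ind) (trans (sym (gramDet-combine M b)) vol)
      where
      lem : ∀ d g → g * (d * d - + 1) ≡ d * (d * g) - g
      lem = solve-∀
      cancel : ∀ d g → g ≢ + 0 → d * (d * g) ≡ g → d * d ≡ + 1
      cancel d g g≢0 h = i-j≡0⇒i≡j (d * d) (+ 1) (*-cancel-zero g g≢0 (trans (lem d g) (i≡j⇒i-j≡0 h)))

  unimodular-span : ∀ j → ∃ λ (u : Fin n → ℤ) → ∀ r → Σℤ (λ i → u i * combine M b i r) ≡ b j r
  unimodular-span j with u , h ← rows-span M det²≡1 (δ j) = u , λ r →
    trans (Σ-combine u M b r) (trans (Σ-cong (λ k → cong (_* b k r) (h k))) (Σ-δ j (λ k → b k r)))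

  -- A relation c satisfies c M = 0. The columns of M span as well, so some u has M u equal to the
  -- unit vector at l, and pairing c with it isolates `c l`.
  unimodular-independent : Independent (combine M b)
  unimodular-independent c h l = lem (rows-span (transpose M) (trans (cong (λ d → d * d) (det-transpose M)) det²≡1) (δ l))
    where
    column : ∀ k → Σℤ (λ i → c i * M i k) ≡ + 0
    column = ind (λ k → Σℤ (λ i → c i * M i k)) (λ r → trans (sym (Σ-combine c M b r)) (h r))
    lem : (∃ λ (u : Fin n → ℤ) → ∀ i → Σℤ (λ k → u k * M i k) ≡ δ l i) → c l ≡ + 0
    lem (u , g) = trans (sym (trans (Σ-cong (λ i → *-comm (c i) (δ l i))) (Σ-δ l c)))
      (trans (Σ-cong (λ i → cong (_*_ (c i)) (sym (g i))))
      (trans (Σ-exchange c u M) (Σ-zero (λ k → trans (cong (_*_ (u k)) (column k)) (*-zeroʳ (u k))))))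

-- Rational weights

ι : ℤ → ℚ
ι z = z ℚ./ 1

toℚᵘ-ι : ∀ z → ℚ.toℚᵘ (ι z) ℚᵘ.≃ mkℚᵘ z 0
toℚᵘ-ι z = ℚ.toℚᵘ-fromℚᵘ (mkℚᵘ z 0)

ι-+ : ∀ a b → ι (a + b) ≡ ι a ℚ.+ ι b
ι-+ a b = ℚ.toℚᵘ-injective (ℚᵘ.≃-trans (toℚᵘ-ι (a + b)) (ℚᵘ.≃-sym
  (ℚᵘ.≃-trans (ℚ.toℚᵘ-homo-+ (ι a) (ι b)) (ℚᵘ.≃-trans (ℚᵘ.+-cong (toℚᵘ-ι a) (toℚᵘ-ι b)) (ℚᵘ.*≡* (lem a b))))))
  where
  lem : ∀ a b → (a * + 1 + b * + 1) * + 1 ≡ (a + b) * + 1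
  lem = solve-∀

ι-* : ∀ a b → ι (a * b) ≡ ι a ℚ.* ι b
ι-* a b = ℚ.toℚᵘ-injective (ℚᵘ.≃-trans (toℚᵘ-ι (a * b)) (ℚᵘ.≃-sym
  (ℚᵘ.≃-trans (ℚ.toℚᵘ-homo-* (ι a) (ι b)) (ℚᵘ.≃-trans (ℚᵘ.*-cong (toℚᵘ-ι a) (toℚᵘ-ι b)) (ℚᵘ.*≡* refl)))))

ι-injective : ∀ {a b} → ι a ≡ ι b → a ≡ b
ι-injective {a} {b} h with ℚᵘ.≃-trans (ℚᵘ.≃-sym (toℚᵘ-ι a)) (ℚᵘ.≃-trans (ℚᵘ.≃-reflexive (cong ℚ.toℚᵘ h)) (toℚᵘ-ι b))
... | ℚᵘ.*≡* e = trans (sym (*-identityʳ a)) (trans e (*-identityʳ b))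

ι-nonneg : ∀ {a} → + 0 ℤ.≤ a → 0ℚ ℚ.≤ ι a
ι-nonneg {a} h = ℚ.toℚᵘ-cancel-≤ (ℚᵘ.≤-respʳ-≃ (ℚᵘ.≃-sym (toℚᵘ-ι a)) (ℚᵘ.*≤* (subst (+ 0 ℤ.≤_) (sym (*-identityʳ a)) h)))

ι-nonneg⁻¹ : ∀ {a} → 0ℚ ℚ.≤ ι a → + 0 ℤ.≤ a
ι-nonneg⁻¹ {a} h with ℚᵘ.≤-respʳ-≃ (toℚᵘ-ι a) (ℚ.toℚᵘ-mono-≤ h)
... | ℚᵘ.*≤* e = subst (+ 0 ℤ.≤_) (*-identityʳ a) e

*-nonneg : ∀ {p q} → 0ℚ ℚ.≤ p → 0ℚ ℚ.≤ q → 0ℚ ℚ.≤ p ℚ.* q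
*-nonneg {p} {q} hp hq = subst (ℚ._≤ p ℚ.* q) (ℚ.*-zeroʳ p) (ℚ.*-monoˡ-≤-nonNeg p ⦃ ℚ.nonNegative hp ⦄ hq)

recip : ℕ → ℚ
recip n = + 1 ℚ./ suc n

recip-* : ∀ n → recip n ℚ.* ι (+ suc n) ≡ 1ℚ
recip-* n = ℚ.toℚᵘ-injective (ℚᵘ.≃-trans (ℚ.toℚᵘ-homo-* (recip n) (ι (+ suc n)))
  (ℚᵘ.≃-trans (ℚᵘ.*-cong (ℚ.toℚᵘ-fromℚᵘ (mkℚᵘ (+ 1) n)) (toℚᵘ-ι (+ suc n)))
    (ℚᵘ.*≡* (lem (+ suc n)))))
  where
  lem : ∀ a → (+ 1 * a) * + 1 ≡ + 1 * (a * + 1)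
  lem = solve-∀

recip-nonneg : ∀ n → 0ℚ ℚ.≤ recip n
recip-nonneg n = ℚ.toℚᵘ-cancel-≤ (ℚᵘ.≤-respʳ-≃ (ℚᵘ.≃-sym (ℚ.toℚᵘ-fromℚᵘ (mkℚᵘ (+ 1) n))) (ℚᵘ.*≤* (ℤ.+≤+ ℕ.z≤n)))

Σℚ-cong : ∀ {n} {f g : Fin n → ℚ} → f ≗ g → Σℚ f ≡ Σℚ g
Σℚ-cong {zero} h = refl
Σℚ-cong {suc n} h = cong₂ ℚ._+_ (h zero) (Σℚ-cong (h ∘ suc))

Σℚ-*ˡ : ∀ {n} q (f : Fin n → ℚ) → Σℚ (λ i → q ℚ.* f i) ≡ q ℚ.* Σℚ f
Σℚ-*ˡ {zero} q f = sym (ℚ.*-zeroʳ q)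
Σℚ-*ˡ {suc n} q f = trans (cong (ℚ._+_ (q ℚ.* f zero)) (Σℚ-*ˡ q (f ∘ suc))) (sym (ℚ.*-distribˡ-+ q (f zero) _))

Σℚ-ι : ∀ {n} (f : Fin n → ℤ) → Σℚ (ι ∘ f) ≡ ι (Σℤ f)
Σℚ-ι {zero} f = refl
Σℚ-ι {suc n} f = trans (cong (ℚ._+_ (ι (f zero))) (Σℚ-ι (f ∘ suc))) (sym (ι-+ (f zero) (Σℤ (f ∘ suc))))

clear-denominator : ∀ q → ∃ λ d → ∃ λ z → ι (+ suc d) ℚ.* q ≡ ι z
clear-denominator q@(ℚ.mkℚ z d _) = d , z , ℚ.toℚᵘ-injective
  (ℚᵘ.≃-trans (ℚ.toℚᵘ-homo-* (ι (+ suc d)) q)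
  (ℚᵘ.≃-trans (ℚᵘ.*-congʳ (toℚᵘ-ι (+ suc d)))
  (ℚᵘ.≃-trans (ℚᵘ.*≡* (lem (+ suc d) z)) (ℚᵘ.≃-sym (toℚᵘ-ι z)))))
  where
  lem : ∀ d z → (d * z) * + 1 ≡ z * (+ 1 * d)
  lem = solve-∀

common-denominator : ∀ {n} (q : Fin n → ℚ) → ∃ λ d → ∃ λ (z : Fin n → ℤ) → ∀ i → ι (+ suc d) ℚ.* q i ≡ ι (z i)
common-denominator {zero} q = zero , (λ ()) , λ ()
common-denominator {suc n} q = combined (clear-denominator (q zero)) (common-denominator (q ∘ suc))
  where
  combined : (∃ λ d → ∃ λ z → ι (+ suc d) ℚ.* q zero ≡ ι z) →
    (∃ λ d → ∃ λ (z : Fin n → ℤ) → ∀ i → ι (+ suc d) ℚ.* q (suc i) ≡ ι (z i)) →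
    ∃ λ d → ∃ λ (z : Fin (suc n) → ℤ) → ∀ i → ι (+ suc d) ℚ.* q i ≡ ι (z i)
  -- Denominators are stored as predecessors; this is the predecessor of (d₀ + 1)(d + 1).
  combined (d₀ , z₀ , h₀) (d , z , h) = d ℕ.+ d₀ ℕ.* suc d , (+ suc d * z₀) ∷ᶠ (λ i → + suc d₀ * z i) , λ
    { zero → trans (cong (ℚ._* q zero) (trans (cong ι (trans (pos-* (suc d₀) (suc d)) (*-comm (+ suc d₀) (+ suc d)))) (ι-* (+ suc d) (+ suc d₀))))
        (trans (ℚ.*-assoc (ι (+ suc d)) (ι (+ suc d₀)) (q zero)) (trans (cong (ℚ._*_ (ι (+ suc d))) h₀) (sym (ι-* (+ suc d) z₀))))
    ; (suc i) → trans (cong (ℚ._* q (suc i)) (trans (cong ι (pos-* (suc d₀) (suc d))) (ι-* (+ suc d₀) (+ suc d))))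
        (trans (ℚ.*-assoc (ι (+ suc d₀)) (ι (+ suc d)) (q (suc i))) (trans (cong (ℚ._*_ (ι (+ suc d₀))) (h i)) (sym (ι-* (+ suc d₀) (z i)))))
    }

-- Moves a membership of the rational point w / (N + 1) into ℤ: z consists of the barycentric
-- weights times a common denominator d + 1, and the last equation is cleared of both denominators.
integer-weights : ∀ {m k} (v : Fin k → Pt m) {x : Ptℚ m} N (w : Pt m) → (∀ r → x r ≡ recip N ℚ.* ι (w r)) → InConv v x →
  ∃ λ d → ∃ λ (z : Fin k → ℤ) → (∀ i → + 0 ℤ.≤ z i) × Σℤ z ≡ + suc d ×
    (∀ r → + suc N * Σℤ (λ i → z i * v i r) ≡ + suc d * w r)
integer-weights {m} {k} v {x} N w hx (λ' , nonneg , total , pos) = scaled (common-denominator λ')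
  where
  scaled : (∃ λ d → ∃ λ (z : Fin k → ℤ) → ∀ i → ι (+ suc d) ℚ.* λ' i ≡ ι (z i)) → _
  scaled (d , z , h) = d , z
    , (λ i → ι-nonneg⁻¹ (subst (0ℚ ℚ.≤_) (h i) (*-nonneg (ι-nonneg {+ suc d} (ℤ.+≤+ ℕ.z≤n)) (nonneg i))))
    , ι-injective (trans (sym (Σℚ-ι z)) (trans (sym (Σℚ-cong h)) (trans (Σℚ-*ˡ (ι (+ suc d)) λ')
        (trans (cong (ℚ._*_ (ι (+ suc d))) total) (ℚ.*-identityʳ (ι (+ suc d)))))))
    , λ r → ι-injective (trans (ι-* (+ suc N) (Σℤ (λ i → z i * v i r)))
        (trans (cong (ℚ._*_ (ι (+ suc N))) (trans (moment r) (trans (cong (ℚ._*_ (ι (+ suc d))) (hx r))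
          (trans (sym (ℚ.*-assoc (ι (+ suc d)) (recip N) (ι (w r))))
          (trans (cong (ℚ._* ι (w r)) (ℚ.*-comm (ι (+ suc d)) (recip N))) (ℚ.*-assoc (recip N) (ι (+ suc d)) (ι (w r))))))))
        (trans (sym (ℚ.*-assoc (ι (+ suc N)) (recip N) (ι (+ suc d) ℚ.* ι (w r))))
        (trans (cong (ℚ._* (ι (+ suc d) ℚ.* ι (w r))) (trans (ℚ.*-comm (ι (+ suc N)) (recip N)) (recip-* N)))
        (trans (ℚ.*-identityˡ (ι (+ suc d) ℚ.* ι (w r))) (sym (ι-* (+ suc d) (w r))))))))
    where
    moment : ∀ r → ι (Σℤ (λ i → z i * v i r)) ≡ ι (+ suc d) ℚ.* x r
    moment r = trans (sym (Σℚ-ι (λ i → z i * v i r)))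
      (trans (Σℚ-cong (λ i → trans (ι-* (z i) (v i r)) (trans (cong (ℚ._* ι (v i r)) (sym (h i))) (ℚ.*-assoc (ι (+ suc d)) (λ' i) (ι (v i r))))))
      (trans (Σℚ-*ˡ (ι (+ suc d)) (λ i → λ' i ℚ.* ι (v i r))) (cong (ℚ._*_ (ι (+ suc d))) (pos r))))

rational-weights : ∀ {m k} (v : Fin k → Pt m) N (z : Fin k → ℤ) (w : Pt m) → Σℤ z ≡ + suc N →
  (∀ r → Σℤ (λ i → z i * v i r) ≡ w r) →
  Σℚ (λ i → recip N ℚ.* ι (z i)) ≡ 1ℚ ×
  (∀ r → Σℚ (λ i → (recip N ℚ.* ι (z i)) ℚ.* (v i r ℚ./ 1)) ≡ recip N ℚ.* ι (w r))
rational-weights v N z w total moment =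
    trans (Σℚ-*ˡ (recip N) (ι ∘ z)) (trans (cong (ℚ._*_ (recip N)) (trans (Σℚ-ι z) (cong ι total))) (recip-* N))
  , λ r → trans (Σℚ-cong (λ i → trans (ℚ.*-assoc (recip N) (ι (z i)) (ι (v i r))) (cong (ℚ._*_ (recip N)) (sym (ι-* (z i) (v i r))))))
      (trans (Σℚ-*ˡ (recip N) (λ i → ι (z i * v i r))) (cong (ℚ._*_ (recip N)) (trans (Σℚ-ι (λ i → z i * v i r)) (cong ι (moment r)))))

-- Convex and affine combinations of the columns and their negatives

Σ-splitAt : ∀ m {n} (F : Fin m ⊎ Fin n → ℤ) → Σℤ (λ k → F (splitAt m k)) ≡ Σℤ (F ∘ inj₁) + Σℤ (F ∘ inj₂)
Σ-splitAt zero F = sym (+-identityˡ (Σℤ (F ∘ inj₂)))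
Σ-splitAt (suc m) F = trans (cong (_+_ (F (inj₁ zero))) (Σ-splitAt m (F ∘ Sum.map₁ suc)))
  (sym (+-assoc (F (inj₁ zero)) (Σℤ (F ∘ inj₁ ∘ suc)) (Σℤ (F ∘ inj₂))))

module _ {m s} (A : Mat m s) (p q : Fin s → ℤ) where

  signed-weights : Fin (s ℕ.+ s) → ℤ
  signed-weights k = [ p , q ]′ (splitAt s k)

  Σ-signed-weights : Σℤ signed-weights ≡ Σℤ (λ l → p l + q l)
  Σ-signed-weights = trans (Σ-splitAt s [ p , q ]′) (sym (Σ-+ p q))

  Σ-signed-columns : ∀ r → Σℤ (λ k → signed-weights k * cols± A k r) ≡ Σℤ (λ l → (p l - q l) * A r l)
  Σ-signed-columns r = trans (Σ-cong by-side) (trans (Σ-splitAt s F)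
    (trans (sym (Σ-+ (F ∘ inj₁) (F ∘ inj₂))) (Σ-cong (λ l → lem (p l) (q l) (A r l)))))
    where
    F : Fin s ⊎ Fin s → ℤ
    F = [ (λ l → p l * A r l) , (λ l → q l * - A r l) ]′
    by-side : ∀ k → signed-weights k * cols± A k r ≡ F (splitAt s k)
    by-side k with splitAt s k
    ... | inj₁ l = refl
    ... | inj₂ l = refl
    lem : ∀ p q a → p * a + q * (- a) ≡ (p - q) * a
    lem = solve-∀

  -- Here p weighs the columns and q their negatives, so the position depends on p - q and the total
  -- weight on p + q.
  inConv-cols± : ∀ N (w : Pt m) → (∀ l → + 0 ℤ.≤ p l) → (∀ l → + 0 ℤ.≤ q l) → Σℤ (λ l → p l + q l) ≡ + suc N →
    (∀ r → Σℤ (λ l → (p l - q l) * A r l) ≡ w r) → InConv (cols± A) (λ r → recip N ℚ.* ι (w r))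
  inConv-cols± N w p≥0 q≥0 total moment = (λ k → recip N ℚ.* ι (signed-weights k))
    , (λ k → *-nonneg (recip-nonneg N) (ι-nonneg (nonneg k)))
    , rational-weights (cols± A) N signed-weights w (trans Σ-signed-weights total) (λ r → trans (Σ-signed-columns r) (moment r))
    where
    nonneg : ∀ k → + 0 ℤ.≤ signed-weights k
    nonneg k with splitAt s k
    ... | inj₁ l = p≥0 l
    ... | inj₂ l = q≥0 l

  inAff-cols± : ∀ N (w : Pt m) → Σℤ (λ l → p l + q l) ≡ + suc N →
    (∀ r → Σℤ (λ l → (p l - q l) * A r l) ≡ w r) → InAff (cols± A) (λ r → recip N ℚ.* ι (w r))
  inAff-cols± N w total moment = (λ k → recip N ℚ.* ι (signed-weights k))
    , rational-weights (cols± A) N signed-weights w (trans Σ-signed-weights total) (λ r → trans (Σ-signed-columns r) (moment r))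

-- The affine hull of ±A contains the origin: the weights d are completed to total weight one by
-- putting half of the defect on the first column and half on its negative, hence the denominator two.
columns-inL : ∀ {m n} (A : Mat m (suc n)) (d : Fin (suc n) → ℤ) (x : Pt m) →
  (∀ r → Σℤ (λ l → d l * A r l) ≡ x r) → InL A x
columns-inL {m} {n} A d x h = halve (inAff-cols± A p q 1 (λ r → + 2 * x r) total moment)
  where
  q p : Fin (suc n) → ℤ
  q l = (+ 1 - Σℤ d) * δ zero l
  p l = + 2 * d l + q l
  total : Σℤ (λ l → p l + q l) ≡ + 2
  total = trans (Σ-cong (λ l → lem₁ (d l) (+ 1 - Σℤ d) (δ zero l)))
    (trans (Σ-linear (+ 2) (+ 2 * (+ 1 - Σℤ d)) d (λ l → δ zero l * + 1))
    (trans (cong (λ t → + 2 * Σℤ d + + 2 * (+ 1 - Σℤ d) * t) (Σ-δ {suc n} zero (λ _ → + 1))) (lem₂ (Σℤ d))))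
    where
    lem₁ : ∀ d e z → (+ 2 * d + e * z) + e * z ≡ + 2 * d + + 2 * e * (z * + 1)
    lem₁ = solve-∀
    lem₂ : ∀ s → + 2 * s + + 2 * (+ 1 - s) * + 1 ≡ + 2
    lem₂ = solve-∀
  moment : ∀ r → Σℤ (λ l → (p l - q l) * A r l) ≡ + 2 * x r
  moment r = trans (Σ-cong (λ l → lem (d l) (q l) (A r l))) (trans (Σ-*ˡ (+ 2) (λ l → d l * A r l)) (cong (_*_ (+ 2)) (h r)))
    where
    lem : ∀ d q a → ((+ 2 * d + q) - q) * a ≡ + 2 * (d * a)
    lem = solve-∀
  halve : InAff (cols± A) (λ r → recip 1 ℚ.* ι (+ 2 * x r)) → InL A x
  halve (μ , total , moment) = μ , total , λ r → trans (moment r)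
    (trans (cong (ℚ._*_ (recip 1)) (ι-* (+ 2) (x r)))
    (trans (sym (ℚ.*-assoc (recip 1) (ι (+ 2)) (ι (x r))))
    (trans (cong (ℚ._* ι (x r)) (recip-* 1)) (ℚ.*-identityˡ (ι (x r))))))

-- The kernel of A

-- The inner sum is the image of the weights c under f, so this is a change of variables.
Σ-pushforward : ∀ {n k} (f : Fin n → Fin k) (c : Fin n → ℤ) (g : Fin k → ℤ) →
  Σℤ (λ l → Σℤ (λ i → c i * δ (f i) l) * g l) ≡ Σℤ (λ i → c i * g (f i))
Σ-pushforward f c g = trans (Σ-cong (λ l → sym (Σ-*ʳ (g l) (λ i → c i * δ (f i) l))))
  (trans (Σ-swap (λ l i → c i * δ (f i) l * g l))
  (Σ-cong (λ i → trans (Σ-cong (λ l → *-assoc (c i) (δ (f i) l) (g l)))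
    (trans (Σ-*ˡ (c i) (λ l → δ (f i) l * g l)) (cong (_*_ (c i)) (Σ-δ (f i) g))))))

Σ-fibre : ∀ {n k} (f : Fin n → Fin k) → Injective _≡_ _≡_ f → ∀ (c : Fin n → ℤ) j → Σℤ (λ i → c i * δ (f i) (f j)) ≡ c j
Σ-fibre f inj c j = trans (Σ-single j (λ i → c i * δ (f i) (f j)) λ i i≢j →
    trans (cong (_*_ (c i)) (δ-≢ (i≢j ∘ inj))) (*-zeroʳ (c i)))
  (trans (cong (_*_ (c j)) (δ-refl (f j))) (*-identityʳ (c j)))

injective-omits : ∀ {n} (f : Fin n → Fin (suc n)) → Injective _≡_ _≡_ f → ∃ λ i₀ → ∀ k → f k ≢ i₀
injective-omits {n} f inj = let i₀ , omitted = ¬∀⟶∃¬ (suc n) _ (λ i → any? (λ k → f k ≟ i)) not-onto in i₀ , λ k e → omitted (k , e)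
  where
  not-onto : ¬ (∀ i → ∃ λ k → f k ≡ i)
  not-onto onto = ℕ.1+n≰n (injective⇒≤ {f = proj₁ ∘ onto} λ {x} {y} e →
    trans (sym (proj₂ (onto x))) (trans (cong f e) (proj₂ (onto y))))

-- Pigeonhole: if l were missed too, adjoining it to f would inject n + 1 elements into the n
-- indices other than i₀.
injective-covers : ∀ {n} (f : Fin n → Fin (suc n)) → Injective _≡_ _≡_ f → ∀ {i₀} → (∀ k → f k ≢ i₀) →
  ∀ l → l ≢ i₀ → ∃ λ k → f k ≡ l
injective-covers {n} f inj {i₀} omitted l l≢i₀ with any? (λ k → f k ≟ l)
... | yes hit = hit
... | no missed = ⊥-elim (ℕ.1+n≰n (injective⇒≤ {f = g} λ {x} {y} e → h-injective x y (punchOut-injective (avoid x) (avoid y) e)))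
  where
  h : Fin (suc n) → Fin (suc n)
  h = l ∷ᶠ f
  avoid : ∀ x → i₀ ≢ h x
  avoid zero = l≢i₀ ∘ sym
  avoid (suc k) = omitted k ∘ sym
  g : Fin (suc n) → Fin n
  g x = punchOut (avoid x)
  h-injective : ∀ x y → h x ≡ h y → x ≡ y
  h-injective zero zero e = refl
  h-injective zero (suc y) e = ⊥-elim (missed (y , sym e))
  h-injective (suc x) zero e = ⊥-elim (missed (x , e))
  h-injective (suc x) (suc y) e = cong suc (inj e)

InKer-linear : ∀ {m s} (A : Mat m s) x y u v → InKer A u → InKer A v → InKer A (λ l → x * u l + y * v l)
InKer-linear A x y u v hu hv r = trans (Σ-cong (λ l → lem (A r l) x y (u l) (v l)))
  (trans (Σ-linear x y (λ l → A r l * u l) (λ l → A r l * v l))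
  (trans (cong₂ (λ p q → x * p + y * q) (hu r) (hv r)) (cong₂ _+_ (*-zeroʳ x) (*-zeroʳ y))))
  where
  lem : ∀ a x y u v → a * (x * u + y * v) ≡ x * (a * u) + y * (a * v)
  lem = solve-∀

sgn-* : ∀ p x → sgn (+ suc p * x) ≡ sgn x
sgn-* p (+ zero) = cong sgn (*-zeroʳ (+ suc p))
sgn-* p (+ suc k) = refl
sgn-* p ℤ.-[1+ k ] = refl

sgn*i≡∣i∣ : ∀ i → sgn i * i ≡ + ∣ i ∣
sgn*i≡∣i∣ (+ zero) = refl
sgn*i≡∣i∣ (+ suc n) = *-identityˡ (+ suc n)
sgn*i≡∣i∣ ℤ.-[1+ n ] = cong +_ (ℕ.+-identityʳ (suc n))

module _ {m n} (A : Mat m (suc n)) (rank : HasRank A n) where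

  -- Take for i₀ the index left out by n independent columns. A kernel vector that is zero there is
  -- a relation among those columns. So a kernel vector is determined by its entry at i₀.
  kernel-pivot : ∃ λ i₀ → ∀ v → InKer A v → v i₀ ≡ + 0 → ∀ l → v l ≡ + 0
  kernel-pivot with proj₁ rank
  ... | f , inj , indep with injective-omits f inj
  ... | i₀ , omitted = i₀ , vanishes
    where
    vanishes : ∀ v → InKer A v → v i₀ ≡ + 0 → ∀ l → v l ≡ + 0
    vanishes v ker v₀ l with l ≟ i₀
    ... | yes refl = v₀
    ... | no l≢i₀ with injective-covers f inj omitted l l≢i₀
    ... | k , refl = indep (v ∘ f) (λ r → trans (relation r) (ker r)) k
      where
      -- The sum is the indicator of the image of f, which misses only i₀, where v is zero; this
      -- reindexes the kernel equation by f.
      hits : ∀ l → Σℤ (λ i → + 1 * δ (f i) l) * v l ≡ v l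
      hits l with l ≟ i₀
      ... | yes refl = trans (cong (_*_ (Σℤ (λ i → + 1 * δ (f i) l))) v₀) (trans (*-zeroʳ (Σℤ (λ i → + 1 * δ (f i) l))) (sym v₀))
      ... | no l≢i₀ with injective-covers f inj omitted l l≢i₀
      ... | k , refl = trans (cong (_* v (f k)) (Σ-fibre f inj (λ _ → + 1) k)) (*-identityˡ (v (f k)))
      relation : ∀ r → Σℤ (λ i → v (f i) * A r (f i)) ≡ Σℤ (λ l → A r l * v l)
      relation r = trans (Σ-cong (λ i → trans (*-comm (v (f i)) (A r (f i))) (sym (*-identityˡ (A r (f i) * v (f i))))))
        (trans (sym (Σ-pushforward f (λ _ → + 1) (λ l → A r l * v l)))
        (Σ-cong (λ l → trans (lem (Σℤ (λ i → + 1 * δ (f i) l)) (A r l) (v l)) (cong (_*_ (A r l)) (hits l)))))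
        where
        lem : ∀ s a v → s * (a * v) ≡ a * (s * v)
        lem = solve-∀

  -- The remainder of c i₀ modulo a i₀ would otherwise give a kernel vector with the signs of a and smaller entries.
  kernel-multiple : ∀ {a} → MinDep A a → ∀ c → InKer A c → ∃ λ t → ∀ l → c l ≡ t * a l
  kernel-multiple {a} (a∈ker , a≢0 , minimal) c c∈ker with kernel-pivot
  ... | i₀ , vanishes = multiple
    where
    α : ℤ
    α = a i₀
    α≢0 : α ≢ + 0
    α≢0 h = a≢0 (vanishes a a∈ker h)
    instance
      α-nonZero : ℤ.NonZero α
      α-nonZero = ℤ.≢-nonZero α≢0
    q : ℤ
    q = c i₀ ℤ./ α
    ρ : ℕ
    ρ = c i₀ ℤ.% α
    c′ : Fin (suc n) → ℤ
    c′ l = + 1 * c l + - q * a l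
    c′∈ker : InKer A c′
    c′∈ker = InKer-linear A (+ 1) (- q) c a c∈ker a∈ker
    c′₀ : c′ i₀ ≡ + ρ
    c′₀ = trans (cong (λ z → + 1 * z + - q * α) (a≡a%n+[a/n]*n (c i₀) α)) (lem (+ ρ) q α)
      where
      lem : ∀ ρ q α → + 1 * (ρ + q * α) + - q * α ≡ ρ
      lem = solve-∀
    proportional : ∀ l → α * c′ l ≡ + ρ * a l
    -- Both sides are kernel vectors with the entry α ρ at i₀.
    proportional l = i-j≡0⇒i≡j (α * c′ l) (+ ρ * a l) (trans (lem α (c′ l) (+ ρ) (a l))
      (vanishes (λ l → α * c′ l + - + ρ * a l) (InKer-linear A α (- + ρ) c′ a c′∈ker a∈ker)
        (trans (cong (λ z → α * z + - + ρ * α) c′₀) (lem₀ α (+ ρ))) l))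
      where
      lem : ∀ α c ρ a → α * c - ρ * a ≡ α * c + - ρ * a
      lem = solve-∀
      lem₀ : ∀ α ρ → α * ρ + - ρ * α ≡ + 0
      lem₀ = solve-∀

    -- The factor `sgn α` replaces the ratio ρ / α between c′ and a by ρ / |α|, which lies in [0,
    -- 1). For ρ > 0 minimality then makes `aligned` equal to a, and comparing at i₀ yields ρ = |α|.
    aligned : Fin (suc n) → ℤ
    aligned l = sgn α * c′ l + + 0 * a l
    aligned∈ker : InKer A aligned
    aligned∈ker = InKer-linear A (sgn α) (+ 0) c′ a c′∈ker a∈ker
    scaled : ∀ l → + ∣ α ∣ * aligned l ≡ sgn α * sgn α * (+ ρ * a l)
    scaled l = trans (cong (_* aligned l) (sym (sgn*i≡∣i∣ α))) (trans (lem (sgn α) α (c′ l) (a l)) (cong (_*_ (sgn α * sgn α)) (proportional l)))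
      where
      lem : ∀ s α c a → s * α * (s * c + + 0 * a) ≡ s * s * (α * c)
      lem = solve-∀
    sgn² : ∀ i → i ≢ + 0 → sgn i * sgn i ≡ + 1
    sgn² (+ zero) h = ⊥-elim (h refl)
    sgn² (+ suc _) h = refl
    sgn² ℤ.-[1+ _ ] h = refl
    scaled′ : ∀ l → + ∣ α ∣ * aligned l ≡ + ρ * a l
    scaled′ l = trans (scaled l) (trans (cong (_* (+ ρ * a l)) (sgn² α α≢0)) (*-identityˡ (+ ρ * a l)))

    no-remainder : ∀ r k → r ≡ ρ → ∣ α ∣ ≡ k → r ≡ 0
    no-remainder zero _ _ _ = refl
    no-remainder (suc r) zero _ eα = ⊥-elim (α≢0 (∣i∣≡0⇒i≡0 eα))
    no-remainder (suc r) (suc p) e eα = ⊥-elim (ℕ.<-irrefl (ℤ-eq same) ρ<)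
      where
      scaled″ : ∀ l → + suc p * aligned l ≡ + suc r * a l
      scaled″ l = trans (cong (λ z → + z * aligned l) (sym eα)) (trans (scaled′ l) (cong (λ z → + z * a l) (sym e)))
      ρ< : suc r ℕ.< suc p
      ρ< = subst₂ ℕ._<_ (sym e) eα (n%d<d (c i₀) α)
      abs″ : ∀ l → suc p ℕ.* ∣ aligned l ∣ ≡ suc r ℕ.* ∣ a l ∣
      abs″ l = trans (sym (abs-* (+ suc p) (aligned l))) (trans (cong ∣_∣ (scaled″ l)) (abs-* (+ suc r) (a l)))
      same : aligned ≗ a
      same = minimal aligned aligned∈ker
        (λ l → trans (sym (sgn-* p (aligned l))) (trans (cong sgn (scaled″ l)) (sgn-* r (a l))))
        (λ l → ℕ.*-cancelˡ-≤ (suc p) (ℕ.≤-trans (ℕ.≤-reflexive (abs″ l)) (ℕ.*-monoˡ-≤ ∣ a l ∣ (ℕ.<⇒≤ ρ<))))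
      ℤ-eq : aligned ≗ a → suc r ≡ suc p
      ℤ-eq h = ℕ.*-cancelʳ-≡ (suc r) (suc p) (suc p)
        (trans (trans (cong (suc r ℕ.*_) (sym eα)) (trans (sym (abs″ i₀)) (cong (λ z → suc p ℕ.* ∣ z ∣) (h i₀)))) (cong (suc p ℕ.*_) eα))

    multiple : ∃ λ t → ∀ l → c l ≡ t * a l
    multiple = q , λ l → trans (lem (c l) q (a l)) (trans (cong (_+ q * a l)
      (*-cancel-zero α α≢0 (trans (proportional l) (trans (cong (λ z → + z * a l) (no-remainder ρ ∣ α ∣ refl refl)) (*-zeroˡ (a l))))))
      (+-identityˡ (q * a l)))
      where
      lem : ∀ c q a → c ≡ (+ 1 * c + - q * a) + q * a
      lem = solve-∀

-- Unimodular simplices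

unit² : ∀ ε → ∣ ε ∣ ≡ 1 → ε * ε ≡ + 1
unit² (+ suc zero) _ = refl
unit² ℤ.-[1+ zero ] _ = refl

data Vertex {m s} (A : Mat m s) (x : Pt m) : Set where
  origin : x ≗ zeroPt → Vertex A x
  ±column : ∀ l ε → ∣ ε ∣ ≡ 1 → (∀ r → x r ≡ ε * A r l) → Vertex A x

module _ {m s} {A : Mat m s} {x : Pt m} where

  -- A preimage of the vertex under A. Equations between points lift to such preimages up to a
  -- kernel vector, which is how the dependency a enters.
  coeff : Vertex A x → Fin s → ℤ
  coeff (origin _) _ = + 0
  coeff (±column l ε _ _) k = ε * δ l k

  coeff-sum : ∀ v r → Σℤ (λ k → coeff v k * A r k) ≡ x r
  coeff-sum (origin x≡0) r = trans (Σ-zero (λ k → *-zeroˡ (A r k))) (sym (x≡0 r))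
  coeff-sum (±column l ε _ h) r = trans (Σ-cong (λ k → *-assoc ε (δ l k) (A r k)))
    (trans (Σ-*ˡ ε (λ k → δ l k * A r k)) (trans (cong (_*_ ε) (Σ-δ l (A r))) (sym (h r))))

  IsOrigin : Vertex A x → Set
  IsOrigin (origin _) = ⊤
  IsOrigin (±column _ _ _ _) = ⊥

  isOrigin? : ∀ v → Dec (IsOrigin v)
  isOrigin? (origin _) = yes tt
  isOrigin? (±column _ _ _ _) = no λ ()

  coeff-origin : ∀ v → IsOrigin v → ∀ k → coeff v k ≡ + 0
  coeff-origin (origin _) _ _ = refl

  Σ-coeff : ∀ l ε → Σℤ (λ k → ε * δ {s} l k) ≡ ε
  Σ-coeff l ε = trans (Σ-cong (λ k → *-comm ε (δ l k))) (Σ-δ l (λ _ → ε))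

  Σ-coeff-odd : ∀ v → ¬ IsOrigin v → ∃ λ h → Σℤ (coeff v) ≡ + 2 * h + + 1
  Σ-coeff-odd (origin _) not = ⊥-elim (not tt)
  Σ-coeff-odd (±column l (+ suc zero) _ _) _ = + 0 , Σ-coeff l (+ 1)
  Σ-coeff-odd (±column l ℤ.-[1+ zero ] _ _) _ = - + 1 , Σ-coeff l (- + 1)

  support-unique : ∀ v {k l} → coeff v k ≢ + 0 → coeff v l ≢ + 0 → k ≡ l
  support-unique (origin _) hk _ = ⊥-elim (hk refl)
  support-unique (±column p ε _ _) {k} {l} hk hl = trans (sym (at k hk)) (at l hl)
    where
    at : ∀ k → ε * δ p k ≢ + 0 → p ≡ k
    at k hk = decidable-stable (p ≟ k) λ p≢k → hk (trans (cong (_*_ ε) (δ-≢ p≢k)) (*-zeroʳ ε))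

  support-column : ∀ v {k} → coeff v k ≢ + 0 → ∃ λ ε → ∣ ε ∣ ≡ 1 × (∀ r → x r ≡ ε * A r k)
  support-column (origin _) hk = ⊥-elim (hk refl)
  support-column v@(±column p ε unit h) {k} hk with support-unique v {p} {k} own hk
    where
    own : ε * δ p p ≢ + 0
    own e with () ← trans (sym unit) (cong ∣_∣ (trans (sym (trans (cong (_*_ ε) (δ-refl p)) (*-identityʳ ε))) e))
  ... | refl = ε , unit , h

classify : ∀ {m s} {A : Mat m s} → Saturated A → ∀ x → LatticePt A x → Vertex A x
classify {m} {s} {A} saturated x lattice with all? (λ r → x r ℤ.≟ + 0)
... | yes x≡0 = origin x≡0
... | no x≢0 with proj₁ (saturated x x≢0 lattice)
... | k , h with splitAt s k
... | inj₁ l = ±column l (+ 1) refl λ r → trans (sym (h r)) (sym (*-identityˡ (A r l)))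
... | inj₂ l = ±column l (- + 1) refl λ r → trans (sym (h r)) (sym (-1*i≡-i (A r l)))

2*i≢1 : ∀ i → + 2 * i ≢ + 1
2*i≢1 i h with () ← ℕ.m*n≡1⇒m≡1 2 ∣ i ∣ (trans (sym (abs-* (+ 2) i)) (cong ∣_∣ h))

module UnimodularSimplex {m n} (A : Mat m (suc n)) {a : Fin (suc n) → ℤ} (a∈ker : InKer A a)
  (kernel : ∀ c → InKer A c → ∃ λ t → ∀ l → c l ≡ t * a l)
  (even : + 2 ∣ Σℤ a) {j : Fin (suc n)} (1<∣aⱼ∣ : 1 ℕ.< ∣ a j ∣)
  {D : ℕ} (b : Fin D → Pt m) (basis : IsBasisL A D b)
  (T : Fin (suc D) → Pt m) (vertex : ∀ v → Vertex A (T v)) (vol : gramDet (edges T) ≡ gramDet b) where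

  C : Fin (suc D) → Fin (suc n) → ℤ
  C v = coeff (vertex v)

  Δ : Fin D → Fin (suc n) → ℤ
  Δ i p = + 1 * C (suc i) p + (- + 1) * C zero p

  columns : Fin (suc n) → Pt m
  columns p r = A r p

  edges-Δ : ∀ i r → combine Δ columns i r ≡ edges T i r
  edges-Δ i r = trans (Σ-cong (λ p → lem (C (suc i) p) (C zero p) (A r p)))
    (trans (Σ-linear (+ 1) (- + 1) (λ p → C (suc i) p * A r p) (λ p → C zero p * A r p))
    (trans (cong₂ (λ x y → + 1 * x + (- + 1) * y) (coeff-sum (vertex (suc i)) r) (coeff-sum (vertex zero) r))
      (lem′ (T (suc i) r) (T zero r))))
    where
    lem : ∀ x y a → (+ 1 * x + (- + 1) * y) * a ≡ + 1 * (x * a) + (- + 1) * (y * a)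
    lem = solve-∀
    lem′ : ∀ x y → + 1 * x + (- + 1) * y ≡ x - y
    lem′ = solve-∀

  private
    -- Edges are integer combinations of columns and thus lie in L, so they arise from b by an
    -- integer matrix M; the volume condition makes M unimodular.
    coordinates : ∀ i → ∃ λ (c : Fin D → ℤ) → ∀ r → Σℤ (λ k → c k * b k r) ≡ edges T i r
    coordinates i = proj₁ (proj₂ basis) (edges T i) (columns-inL A (Δ i) (edges T i) (edges-Δ i))
    M : Fin D → Fin D → ℤ
    M i = proj₁ (coordinates i)
    edges-M : ∀ i r → combine M b i r ≡ edges T i r
    edges-M i = proj₂ (coordinates i)
    vol′ : gramDet (combine M b) ≡ gramDet b
    vol′ = trans (det-cong (λ i j → Σ-cong (λ r → cong₂ _*_ (edges-M i r) (edges-M j r)))) vol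

  edges-independent : Independent (edges T)
  edges-independent c h = unimodular-independent b (proj₂ (proj₂ basis)) M vol′ c λ r →
    trans (Σ-cong (λ i → cong (_*_ (c i)) (edges-M i r))) (h r)

  edges-span : ∀ l → ∃ λ (u : Fin D → ℤ) → ∀ r → Σℤ (λ i → u i * edges T i r) ≡ A r l
  edges-span l = expand (proj₁ (proj₂ basis) (columns l) (columns-inL A (δ l) (columns l) (λ r → Σ-δ l (A r))))
    (λ k → unimodular-span b (proj₂ (proj₂ basis)) M vol′ k)
    where
    expand : (∃ λ (c : Fin D → ℤ) → ∀ r → Σℤ (λ k → c k * b k r) ≡ A r l) →
      (∀ k → ∃ λ (u : Fin D → ℤ) → ∀ r → Σℤ (λ i → u i * combine M b i r) ≡ b k r) →
      ∃ λ (u : Fin D → ℤ) → ∀ r → Σℤ (λ i → u i * edges T i r) ≡ A r l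
    expand (c , hc) B = (λ i → Σℤ (λ k → c k * proj₁ (B k) i)) , λ r →
      trans (sym (Σ-combine c (λ k → proj₁ (B k)) (edges T) r))
      (trans (Σ-cong (λ k → cong (_*_ (c k)) (trans (Σ-cong (λ i → cong (_*_ (proj₁ (B k) i)) (sym (edges-M i r)))) (proj₂ (B k) r)))) (hc r))

  -- The combination of the `Δ i` and the unit vector at l are both preimages of column l under A,
  -- so they differ by a multiple of a.
  column-relation : ∀ l (u : Fin D → ℤ) → (∀ r → Σℤ (λ i → u i * edges T i r) ≡ A r l) →
    ∃ λ t → ∀ p → + 1 * Σℤ (λ i → u i * Δ i p) + (- + 1) * δ l p ≡ t * a p
  column-relation l u h = kernel (λ p → + 1 * Σℤ (λ i → u i * Δ i p) + (- + 1) * δ l p) λ r →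
    trans (Σ-cong (λ p → lem (A r p) (Σℤ (λ i → u i * Δ i p)) (δ l p)))
    (trans (Σ-linear (+ 1) (- + 1) (λ p → Σℤ (λ i → u i * Δ i p) * A r p) (λ p → δ l p * A r p))
    (trans (cong₂ (λ x y → + 1 * x + (- + 1) * y)
      (trans (sym (Σ-combine u Δ columns r)) (trans (Σ-cong (λ i → cong (_*_ (u i)) (edges-Δ i r))) (h r))) (Σ-δ l (A r)))
      (lem′ (A r l))))
    where
    lem : ∀ a x y → a * (+ 1 * x + (- + 1) * y) ≡ + 1 * (x * a) + (- + 1) * (y * a)
    lem = solve-∀
    lem′ : ∀ x → + 1 * x + (- + 1) * x ≡ + 0
    lem′ = solve-∀

  -- Otherwise every edge has even coefficient sum, while the columns do not.
  origin-vertex : ∃ λ v → IsOrigin (vertex v)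
  origin-vertex = decidable-stable (any? (λ v → isOrigin? (vertex v))) λ none →
    let odd = λ v → Σ-coeff-odd (vertex v) (λ o → none (v , o)) in
    contradict (proj₁ ∘ odd) (proj₂ ∘ odd) (edges-span j) (∣ᵤ⇒∣ even)
    where
    contradict : ∀ (h : Fin (suc D) → ℤ) → (∀ v → Σℤ (C v) ≡ + 2 * h v + + 1) →
      (∃ λ (u : Fin D → ℤ) → ∀ r → Σℤ (λ i → u i * edges T i r) ≡ A r j) → (+ 2) Signed.∣ Σℤ a → ⊥
    contradict h odd (u , hu) (divides g even) = relation (column-relation j u hu)
      where
      H : ℤ
      H = Σℤ (λ i → u i * (h (suc i) - h zero))
      Δ-sum : ∀ i → Σℤ (Δ i) ≡ + 2 * (h (suc i) - h zero)
      Δ-sum i = trans (Σ-linear (+ 1) (- + 1) (C (suc i)) (C zero))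
        (trans (cong₂ (λ x y → + 1 * x + (- + 1) * y) (odd (suc i)) (odd zero)) (lem (h (suc i)) (h zero)))
        where
        lem : ∀ x y → + 1 * (+ 2 * x + + 1) + (- + 1) * (+ 2 * y + + 1) ≡ + 2 * (x - y)
        lem = solve-∀
      total : Σℤ (λ p → Σℤ (λ i → u i * Δ i p)) ≡ + 2 * H
      total = trans (Σ-swap (λ p i → u i * Δ i p))
        (trans (Σ-cong (λ i → trans (Σ-*ˡ (u i) (Δ i)) (trans (cong (_*_ (u i)) (Δ-sum i)) (lem (u i) (h (suc i) - h zero)))))
          (Σ-*ˡ (+ 2) (λ i → u i * (h (suc i) - h zero))))
        where
        lem : ∀ u x → u * (+ 2 * x) ≡ + 2 * (u * x)
        lem = solve-∀
      relation : (∃ λ t → ∀ p → + 1 * Σℤ (λ i → u i * Δ i p) + (- + 1) * δ j p ≡ t * a p) → ⊥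
      -- Summing the relation over all p, the edges contribute 2 H, the column -1 and the dependency
      -- 2 t g, so 2 (H - t g) = 1.
      relation (t , ht) = 2*i≢1 (H - t * g) (trans (lem H t g) (trans (cong (λ z → + 2 * H - z) (sym sums)) (lem′ H)))
        where
        sums : + 1 * (+ 2 * H) + (- + 1) * + 1 ≡ t * (g * + 2)
        sums = trans (sym (cong₂ (λ x y → + 1 * x + (- + 1) * y) total (trans (Σ-cong (λ p → sym (*-identityʳ (δ j p)))) (Σ-δ j (λ _ → + 1)))))
          (trans (sym (Σ-linear (+ 1) (- + 1) (λ p → Σℤ (λ i → u i * Δ i p)) (δ j)))
          (trans (Σ-cong ht) (trans (Σ-*ˡ t a) (cong (_*_ t) even))))
        lem : ∀ H t g → + 2 * (H - t * g) ≡ + 2 * H - t * (g * + 2)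
        lem = solve-∀
        lem′ : ∀ H → + 2 * H - (+ 1 * (+ 2 * H) + (- + 1) * + 1) ≡ + 1
        lem′ = solve-∀

  -- As the total is zero, `T zero` may be subtracted from every vertex, which leaves a relation
  -- among the edges; the total then also settles the base vertex.
  affinely-independent : ∀ (γ : Fin (suc D) → ℤ) → Σℤ γ ≡ + 0 → (∀ r → Σℤ (λ v → γ v * T v r) ≡ + 0) → ∀ v → γ v ≡ + 0
  affinely-independent γ total moment = λ
    { zero → trans (sym (+-identityʳ (γ zero))) (trans (cong (_+_ (γ zero)) (sym (Σ-zero tail))) total)
    ; (suc i) → tail i }
    where
    tail : ∀ i → γ (suc i) ≡ + 0
    tail = edges-independent (γ ∘ suc) λ r →
      trans (Σ-cong (λ i → lem (γ (suc i)) (T (suc i) r) (T zero r)))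
      (trans (Σ-linear (+ 1) (- T zero r) (λ i → γ (suc i) * T (suc i) r) (γ ∘ suc))
      (trans (lem′ (Σℤ (λ i → γ (suc i) * T (suc i) r)) (T zero r) (Σℤ (γ ∘ suc)) (γ zero))
      (trans (cong₂ (λ x y → x + (- T zero r) * y) (moment r) total) (trans (+-identityˡ ((- T zero r) * + 0)) (*-zeroʳ (- T zero r))))))
      where
      lem : ∀ g x y → g * (x - y) ≡ + 1 * (g * x) + (- y) * g
      lem = solve-∀
      lem′ : ∀ S t s g → + 1 * S + (- t) * s ≡ (g * t + S) + (- t) * (g + s)
      lem′ = solve-∀

  -- If every column were used up to sign, the dependency a would become an affine dependency of the vertices
  -- once the missing weight is put on the vertex at the origin.
  unused-column : ∃ λ i → ∀ v → C v i ≡ + 0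
  unused-column = let i , unused = ¬∀⟶∃¬ (suc n) _ (λ l → any? (λ v → ¬? (C v l ℤ.≟ + 0))) (λ used → all-used used origin-vertex)
    in i , λ v → decidable-stable (C v i ℤ.≟ + 0) (λ h → unused (v , h))
    where
    all-used : (∀ l → ∃ λ v → C v l ≢ + 0) → (∃ λ v → IsOrigin (vertex v)) → ⊥
    all-used used (o , is-origin) = ℕ.<⇒≢ (ℕ.<-trans (ℕ.s≤s ℕ.z≤n) 1<∣aⱼ∣) (sym (cong ∣_∣ aⱼ≡0))
      where
      f : Fin (suc n) → Fin (suc D)
      f l = proj₁ (used l)
      ε : Fin (suc n) → ℤ
      ε l = proj₁ (support-column (vertex (f l)) (proj₂ (used l)))
      ∣ε∣ : ∀ l → ∣ ε l ∣ ≡ 1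
      ∣ε∣ l = proj₁ (proj₂ (support-column (vertex (f l)) (proj₂ (used l))))
      T-f : ∀ l r → T (f l) r ≡ ε l * A r l
      T-f l = proj₂ (proj₂ (support-column (vertex (f l)) (proj₂ (used l))))
      f-injective : Injective _≡_ _≡_ f
      f-injective {k} {l} e = support-unique (vertex (f k)) (proj₂ (used k)) (subst (λ v → C v l ≢ + 0) (sym e) (proj₂ (used l)))
      f≢o : ∀ l → o ≢ f l
      f≢o l e = proj₂ (used l) (coeff-origin (vertex (f l)) (subst (λ v → IsOrigin (vertex v)) e is-origin) l)
      T-o : ∀ r → T o r ≡ + 0
      T-o r = trans (sym (coeff-sum (vertex o) r)) (Σ-zero (λ k → trans (cong (_* A r k) (coeff-origin (vertex o) is-origin k)) (*-zeroˡ (A r k))))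

      -- The vertex is ε A_l, so the weight a_l ε on it contributes a_l A_l because ε² = 1.
      x : Fin (suc n) → ℤ
      x l = a l * ε l
      S : ℤ
      S = Σℤ x
      push : Fin (suc D) → ℤ
      push v = Σℤ (λ l → x l * δ (f l) v)
      γ : Fin (suc D) → ℤ
      γ v = + 1 * push v + (- S) * δ o v
      total : Σℤ γ ≡ + 0
      total = trans (Σ-linear (+ 1) (- S) push (δ o))
        (trans (cong₂ (λ p q → + 1 * p + (- S) * q)
          (trans (Σ-cong (λ v → sym (*-identityʳ (push v)))) (trans (Σ-pushforward f x (λ _ → + 1)) (Σ-cong (λ l → *-identityʳ (x l)))))
          (trans (Σ-cong (λ v → sym (*-identityʳ (δ o v)))) (Σ-δ o (λ _ → + 1)))) (lem S))
        where
        lem : ∀ S → + 1 * S + (- S) * + 1 ≡ + 0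
        lem = solve-∀
      moment : ∀ r → Σℤ (λ v → γ v * T v r) ≡ + 0
      moment r = trans (Σ-cong (λ v → lem (push v) S (δ o v) (T v r)))
        (trans (Σ-linear (+ 1) (- S) (λ v → push v * T v r) (λ v → δ o v * T v r))
        (trans (cong₂ (λ p q → + 1 * p + (- S) * q)
          (trans (Σ-pushforward f x (λ v → T v r)) (trans (Σ-cong (λ l → unsign l r)) (a∈ker r)))
          (trans (Σ-δ o (λ v → T v r)) (T-o r))) (trans (+-identityˡ ((- S) * + 0)) (*-zeroʳ (- S)))))
        where
        lem : ∀ p S d t → (+ 1 * p + (- S) * d) * t ≡ + 1 * (p * t) + (- S) * (d * t)
        lem = solve-∀
        unsign : ∀ l r → x l * T (f l) r ≡ A r l * a l
        unsign l r = trans (cong (_*_ (x l)) (T-f l r)) (trans (lem″ (a l) (ε l) (A r l)) (trans (cong (_* (A r l * a l)) (unit² (ε l) (∣ε∣ l))) (*-identityˡ (A r l * a l))))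
          where
          lem″ : ∀ a e A → a * e * (e * A) ≡ e * e * (A * a)
          lem″ = solve-∀
      xⱼ≡0 : x j ≡ + 0
      xⱼ≡0 = trans (sym (trans (cong₂ (λ p q → + 1 * p + (- S) * q) (Σ-fibre f f-injective x j) (δ-≢ (f≢o j))) (lem (x j) S)))
        (affinely-independent γ total moment (f j))
        where
        lem : ∀ x S → + 1 * x + (- S) * + 0 ≡ x
        lem = solve-∀
      aⱼ≡0 : a j ≡ + 0
      aⱼ≡0 = [ id , (λ ε≡0 → ⊥-elim (ℕ.0≢1+n (trans (sym (cong ∣_∣ ε≡0)) (∣ε∣ j)))) ]′ (i*j≡0⇒i≡0∨j≡0 (a j) xⱼ≡0)

  unit-index : ∃ λ i → ∣ a i ∣ ≡ 1 × (∀ v → C v i ≡ + 0)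
  unit-index = locate unused-column
    where
    locate : (∃ λ i → ∀ v → C v i ≡ + 0) → ∃ λ i → ∣ a i ∣ ≡ 1 × (∀ v → C v i ≡ + 0)
    locate (i , unused) = i , unit (edges-span i) , unused
      where
      unit : (∃ λ (u : Fin D → ℤ) → ∀ r → Σℤ (λ i → u i * edges T i r) ≡ A r i) → ∣ a i ∣ ≡ 1
      unit (u , hu) = from-relation (column-relation i u hu)
        where
        from-relation : (∃ λ t → ∀ p → + 1 * Σℤ (λ k → u k * Δ k p) + (- + 1) * δ i p ≡ t * a p) → ∣ a i ∣ ≡ 1
        from-relation (t , ht) = ℕ.m*n≡1⇒n≡1 ∣ t ∣ ∣ a i ∣ (trans (sym (abs-* t (a i))) (cong ∣_∣ (trans (sym (ht i))
          (cong₂ (λ x y → + 1 * x + (- + 1) * y)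
            (Σ-zero (λ k → trans (cong (_*_ (u k)) (cong₂ (λ x y → + 1 * x + (- + 1) * y) (unused (suc k)) (unused zero))) (*-zeroʳ (u k))))
            (δ-refl i)))))

-- The supporting functional

i≤∣i∣ : ∀ i → i ℤ.≤ + ∣ i ∣
i≤∣i∣ (+ n) = ≤-refl
i≤∣i∣ ℤ.-[1+ n ] = ℤ.-≤+

-- The sign makes ε x and y opposite. If both are nonzero, the sum is p - q with p + 1 and q + 1
-- their absolute values, so it stays strictly below M. Hence M can be attained only when one of
-- them is 0.
opposing-sign : ∀ {M} x y → 1 ℕ.≤ M → ∣ x ∣ ℕ.≤ M → ∣ y ∣ ℕ.≤ M →
  ∃ λ ε → ∣ ε ∣ ≡ 1 × ∣ ε * x + y ∣ ℕ.≤ M × (∣ ε * x + y ∣ ≡ M → ε * x ≡ ε * x + y ⊎ y ≡ ε * x + y)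
opposing-sign {M} x y 1≤M hx hy = choose x y hx hy
  where
  Goal : ℤ → ℤ → Set
  Goal x y = ∃ λ ε → ∣ ε ∣ ≡ 1 × ∣ ε * x + y ∣ ℕ.≤ M × (∣ ε * x + y ∣ ≡ M → ε * x ≡ ε * x + y ⊎ y ≡ ε * x + y)
  strict : ∀ {x y} ε → ∣ ε ∣ ≡ 1 → ∀ p q → p ℕ.< M → q ℕ.< M → ε * x + y ≡ suc p ℤ.⊖ suc q → Goal x y
  strict {x} {y} ε unit p q p< q< e = ε , unit , ℕ.<⇒≤ small , λ h → ⊥-elim (ℕ.<-irrefl h small)
    where
    small : ∣ ε * x + y ∣ ℕ.< M
    small = ℕ.≤-<-trans (ℕ.≤-trans (ℕ.≤-reflexive (cong ∣_∣ (trans e ([1+m]⊖[1+n]≡m⊖n p q)))) (∣m⊝n∣≤m⊔n p q)) (ℕ.⊔-pres-<m p< q<)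
  choose : ∀ x y → ∣ x ∣ ℕ.≤ M → ∣ y ∣ ℕ.≤ M → Goal x y
  choose x (+ zero) hx hy = + 1 , refl , ℕ.≤-trans (ℕ.≤-reflexive (cong ∣_∣ (sym same))) hx′ , λ _ → inj₁ same
    where
    same : + 1 * x ≡ + 1 * x + + 0
    same = sym (+-identityʳ (+ 1 * x))
    hx′ : ∣ + 1 * x ∣ ℕ.≤ M
    hx′ = ℕ.≤-trans (ℕ.≤-reflexive (cong ∣_∣ (*-identityˡ x))) hx
  choose (+ zero) y hx hy = + 1 , refl , ℕ.≤-trans (ℕ.≤-reflexive (cong ∣_∣ (+-identityˡ y))) hy , λ _ → inj₂ (sym (+-identityˡ y))
  choose x@(+ suc p) y@(+ suc q) hx hy = strict {x} {y} (- + 1) refl q p hy hx (cong (_+ y) (-1*i≡-i x))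
  choose x@(+ suc p) y@(ℤ.-[1+ q ]) hx hy = strict {x} {y} (+ 1) refl p q hx hy (cong (_+ y) (*-identityˡ x))
  choose x@(ℤ.-[1+ p ]) y@(+ suc q) hx hy = strict {x} {y} (+ 1) refl q p hy hx (cong (_+ y) (*-identityˡ x))
  choose x@(ℤ.-[1+ p ]) y@(ℤ.-[1+ q ]) hx hy = strict {x} {y} (- + 1) refl p q hx hy (cong (_+ y) (-1*i≡-i x))

signedSum : ∀ {n} → (Fin n → ℤ) → (Fin n → ℤ) → ℤ
signedSum η b = Σℤ (λ l → η l * b l)

-- Each sign is chosen against the sum of the terms after it, so the bound M can only be attained
-- by a single term of absolute value M that meets the partial sum 0, all terms before it being 0.
greedy-signs : ∀ {n M} (b : Fin n → ℤ) → 1 ℕ.≤ M → (∀ l → ∣ b l ∣ ℕ.≤ M) →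
  ∃ λ (η : Fin n → ℤ) → (∀ l → ∣ η l ∣ ≡ 1) × ∣ signedSum η b ∣ ℕ.≤ M ×
    (∣ signedSum η b ∣ ≡ M → ∃ λ m → η m * b m ≡ signedSum η b)
greedy-signs {zero} b 1≤M hb = (λ ()) , (λ ()) , ℕ.z≤n , λ 0≡M → ⊥-elim (ℕ.<⇒≢ 1≤M 0≡M)
greedy-signs {suc n} {M} b 1≤M hb with greedy-signs (b ∘ suc) 1≤M (hb ∘ suc)
... | η , unit , bounded , attained with opposing-sign (b zero) (signedSum η (b ∘ suc)) 1≤M (hb zero) bounded
... | ε , unit₀ , bounded₀ , tight = ε ∷ᶠ η , (λ { zero → unit₀ ; (suc l) → unit l }) , bounded₀ , attained₀
  where
  attained₀ : ∣ ε * b zero + signedSum η (b ∘ suc) ∣ ≡ M → ∃ λ m → (ε ∷ᶠ η) m * b m ≡ ε * b zero + signedSum η (b ∘ suc)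
  attained₀ e with tight e
  ... | inj₁ h = zero , h
  ... | inj₂ h with attained (trans (cong ∣_∣ h) e)
  ... | m , hm = suc m , trans hm h

Σ-const : ∀ k (c : ℤ) → Σℤ {k} (λ _ → c) ≡ + k * c
Σ-const zero c = sym (*-zeroˡ c)
Σ-const (suc k) c = trans (cong (_+_ c) (Σ-const k c)) (lem c (+ k))
  where
  lem : ∀ c k → c + k * c ≡ (+ 1 + k) * c
  lem = solve-∀

-- The situation in a simplex containing the barycentre, in integers: b is the dependency without
-- its entry at j, scaled by a sign that makes this entry M; ν and νⱼ are d + 1 times the column
-- coordinates of the barycentre in the simplex.
module Clash {n M d : ℕ} (1<M : 1 ℕ.< M) (b η : Fin (suc n) → ℤ) (unit : ∀ l → ∣ η l ∣ ≡ 1)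
  (bounded : ∣ signedSum η b ∣ ℕ.≤ M) (attained : ∣ signedSum η b ∣ ≡ M → ∃ λ m → η m * b m ≡ signedSum η b)
  (ν : Fin (suc n) → ℤ) (νⱼ t : ℤ)
  (rel : ∀ l → + suc n * ν l ≡ + suc d * η l + t * b l) (relⱼ : + suc n * νⱼ ≡ t * + M)
  (mass : Σℤ (λ l → + ∣ ν l ∣) + + ∣ νⱼ ∣ ℤ.≤ + suc d)
  (i : Fin (suc n)) (unitᵢ : ∣ b i ∣ ≡ 1) (νᵢ≡0 : ν i ≡ + 0) where

  private
    N D σ X : ℤ
    N = + suc n
    D = + suc d
    σ = signedSum η b
    X = Σℤ (λ l → η l * ν l)

    η-rel : ∀ l → N * (η l * ν l) ≡ D + t * (η l * b l)
    η-rel l = trans (lem₁ N (η l) (ν l)) (trans (cong (_*_ (η l)) (rel l)) (trans (lem₂ (η l) D t (b l))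
      (trans (cong (λ z → z * D + t * (η l * b l)) (unit² (η l) (unit l))) (cong (_+ t * (η l * b l)) (*-identityˡ D)))))
      where
      lem₁ : ∀ N e v → N * (e * v) ≡ e * (N * v)
      lem₁ = solve-∀
      lem₂ : ∀ e D t b → e * (D * e + t * b) ≡ e * e * D + t * (e * b)
      lem₂ = solve-∀

    NX : N * X ≡ N * D + t * σ
    NX = trans (sym (Σ-*ˡ N (λ l → η l * ν l))) (trans (Σ-cong η-rel)
      (trans (Σ-+ (λ _ → D) (λ l → t * (η l * b l))) (cong₂ _+_ (Σ-const (suc n) D) (Σ-*ˡ t (λ l → η l * b l)))))

    -- The left side is M times the value of the supporting functional y. As y annihilates the
    -- dependency, t drops out, and y is 1 at the barycentre.
    pairing : + M * X - σ * νⱼ ≡ + M * D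
    pairing = *-cancelˡ-≡ N (+ M * X - σ * νⱼ) (+ M * D) (trans (lem₁ N (+ M) X σ νⱼ)
      (trans (cong₂ (λ x y → + M * x - σ * y) NX relⱼ) (lem₂ (+ M) N D t σ)))
      where
      lem₁ : ∀ N M X s v → N * (M * X - s * v) ≡ M * (N * X) - s * (N * v)
      lem₁ = solve-∀
      lem₂ : ∀ M N D t s → M * (N * D + t * s) - s * (t * M) ≡ N * (M * D)
      lem₂ = solve-∀

    -- M times the loss in each coordinate from y being at most 1 in absolute value on the columns.
    -- No loss is negative and their sum is M (mass - D), at most 0, so each of them is zero.
    u : Fin (suc n) → ℤ
    u l = + M * (+ ∣ ν l ∣ - η l * ν l)
    w : ℤ
    w = + M * + ∣ νⱼ ∣ - - σ * νⱼ

    u≥0 : ∀ l → + 0 ℤ.≤ u l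
    u≥0 l = subst (ℤ._≤ u l) (*-zeroʳ (+ M)) (*-monoˡ-≤-nonNeg (+ M) (i≤j⇒0≤j-i
      (≤-trans (i≤∣i∣ (η l * ν l)) (≤-reflexive (cong +_ (trans (abs-* (η l) (ν l)) (trans (cong (ℕ._* ∣ ν l ∣) (unit l)) (ℕ.*-identityˡ ∣ ν l ∣))))))))

    w≥0 : + 0 ℤ.≤ w
    w≥0 = i≤j⇒0≤j-i (≤-trans (i≤∣i∣ (- σ * νⱼ)) (≤-trans
      (ℤ.+≤+ (ℕ.≤-trans (ℕ.≤-reflexive (trans (abs-* (- σ) νⱼ) (cong (ℕ._* ∣ νⱼ ∣) (∣-i∣≡∣i∣ σ)))) (ℕ.*-monoˡ-≤ ∣ νⱼ ∣ bounded)))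
      (≤-reflexive (pos-* M ∣ νⱼ ∣))))

    slack : Σℤ u + w ℤ.≤ + 0
    slack = subst₂ ℤ._≤_ (sym total) (*-zeroʳ (+ M)) (*-monoˡ-≤-nonNeg (+ M) (i≤j⇒i-j≤0 mass))
      where
      S : ℤ
      S = Σℤ (λ l → + ∣ ν l ∣)
      total : Σℤ u + w ≡ + M * (S + + ∣ νⱼ ∣ - D)
      total = trans (cong (_+ w) (trans (Σ-*ˡ (+ M) (λ l → + ∣ ν l ∣ - η l * ν l)) (cong (_*_ (+ M))
          (trans (Σ-cong (λ l → lem₀ (+ ∣ ν l ∣) (η l * ν l))) (Σ-linear (+ 1) (- + 1) (λ l → + ∣ ν l ∣) (λ l → η l * ν l))))))
        (trans (lem₁ (+ M) S X (+ ∣ νⱼ ∣) σ νⱼ) (trans (cong (λ z → + M * (S + + ∣ νⱼ ∣) - z) pairing) (lem₂ (+ M) (S + + ∣ νⱼ ∣) D)))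
        where
        lem₀ : ∀ x y → x - y ≡ + 1 * x + (- + 1) * y
        lem₀ = solve-∀
        lem₁ : ∀ M S X p s v → M * (+ 1 * S + (- + 1) * X) + (M * p - - s * v) ≡ M * (S + p) - (M * X - s * v)
        lem₁ = solve-∀
        lem₂ : ∀ M S D → M * S - M * D ≡ M * (S - D)
        lem₂ = solve-∀

    w≡0 : + M * + ∣ νⱼ ∣ ≡ - σ * νⱼ
    w≡0 = i-j≡0⇒i≡j (+ M * + ∣ νⱼ ∣) (- σ * νⱼ) (≤-antisym
      (≤-trans (subst (ℤ._≤ Σℤ u + w) (+-identityˡ w) (+-monoˡ-≤ w (Σ-nonneg u≥0))) slack) w≥0)

    instance
      M-nonZero : ℕ.NonZero M
      M-nonZero = ℕ.>-nonZero (ℕ.<-trans (ℕ.s≤s ℕ.z≤n) 1<M)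

    M≢0 : + M ≢ + 0
    M≢0 h = ℕ.≢-nonZero⁻¹ M (+-injective h)

    aligned : ∀ l → + ∣ ν l ∣ ≡ η l * ν l
    aligned l = i-j≡0⇒i≡j (+ ∣ ν l ∣) (η l * ν l) (*-cancel-zero (+ M) M≢0 (≤-antisym
      (≤-trans (term≤Σ u≥0 l) (≤-trans (subst (ℤ._≤ Σℤ u + w) (+-identityʳ (Σℤ u)) (+-monoʳ-≤ (Σℤ u) w≥0)) slack)) (u≥0 l)))

    -- At i the relation reads 0 = D ηᵢ + t bᵢ, where ηᵢ and bᵢ have absolute value 1.
    ∣t∣ : ∣ t ∣ ≡ suc d
    ∣t∣ = trans (sym (ℕ.*-identityʳ ∣ t ∣)) (trans (cong (∣ t ∣ ℕ.*_) (sym unitᵢ)) (trans (sym (abs-* t (b i)))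
      (trans (cong ∣_∣ opposite) (trans (∣-i∣≡∣i∣ (D * η i)) (trans (abs-* D (η i)) (trans (cong (suc d ℕ.*_) (unit i)) (ℕ.*-identityʳ (suc d))))))))
      where
      opposite : t * b i ≡ - (D * η i)
      opposite = trans (lem (D * η i) (t * b i)) (trans (cong (_- D * η i) (trans (sym (rel i)) (trans (cong (_*_ N) νᵢ≡0) (*-zeroʳ N)))) (+-identityˡ (- (D * η i))))
        where
        lem : ∀ x y → y ≡ x + y - x
        lem = solve-∀

    ∣N*νⱼ∣ : suc n ℕ.* ∣ νⱼ ∣ ≡ suc d ℕ.* M
    ∣N*νⱼ∣ = trans (sym (abs-* N νⱼ)) (trans (cong ∣_∣ relⱼ) (trans (abs-* t (+ M)) (cong (ℕ._* M) ∣t∣)))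

    ∣νⱼ∣≢0 : ∣ νⱼ ∣ ≢ 0
    ∣νⱼ∣≢0 h = ℕ.≢-nonZero⁻¹ M ([ (λ ()) , id ]′ (ℕ.m*n≡0⇒m≡0∨n≡0 (suc d)
      (trans (sym ∣N*νⱼ∣) (trans (cong (suc n ℕ.*_) h) (ℕ.*-zeroʳ (suc n))))))

    ∣σ∣≡M : ∣ σ ∣ ≡ M
    ∣σ∣≡M = sym (ℕ.*-cancelʳ-≡ M ∣ σ ∣ ∣ νⱼ ∣ ⦃ ℕ.≢-nonZero ∣νⱼ∣≢0 ⦄ (trans (sym (abs-* (+ M) (+ ∣ νⱼ ∣)))
      (trans (cong ∣_∣ w≡0) (trans (abs-* (- σ) νⱼ) (cong (ℕ._* ∣ νⱼ ∣) (∣-i∣≡∣i∣ σ))))))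

    tσ : t * σ ≡ - (D * + M)
    tσ = trans (*-cancelˡ-≡ (+ M) (t * σ) (- (N * + ∣ νⱼ ∣)) (trans (lem₁ (+ M) t σ) (trans (cong (_*_ σ) (sym relⱼ))
        (trans (lem₂ σ N νⱼ) (trans (cong (λ z → - (N * z)) (sym w≡0)) (lem₃ N (+ M) (+ ∣ νⱼ ∣)))))))
      (cong -_ (trans (sym (pos-* (suc n) ∣ νⱼ ∣)) (trans (cong +_ ∣N*νⱼ∣) (pos-* (suc d) M))))
      where
      lem₁ : ∀ M t s → M * (t * s) ≡ s * (t * M)
      lem₁ = solve-∀
      lem₂ : ∀ s N v → s * (N * v) ≡ - (N * (- s * v))
      lem₂ = solve-∀
      lem₃ : ∀ N M v → - (N * (M * v)) ≡ M * - (N * v)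
      lem₃ = solve-∀

    -- At this m the aligned signs give N |ν m| = D + t σ = D - D M, and nonnegativity forces M ≤ 1.
    too-small : (∃ λ m → η m * b m ≡ σ) → ⊥
    too-small (m , hm) = ℕ.<⇒≱ 1<M (ℕ.*-cancelˡ-≤ (suc d) (ℕ.≤-trans (drop‿+≤+ (subst (ℤ._≤ D) (sym (pos-* (suc d) M)) (0≤i-j⇒j≤i
        (subst (+ 0 ℤ.≤_) value (ℤ.+≤+ ℕ.z≤n))))) (ℕ.≤-reflexive (sym (ℕ.*-identityʳ (suc d))))))
      where
      value : + (suc n ℕ.* ∣ ν m ∣) ≡ D - D * + M
      value = trans (pos-* (suc n) ∣ ν m ∣) (trans (cong (_*_ N) (aligned m)) (trans (η-rel m) (cong (_+_ D) (trans (cong (_*_ t) hm) tσ))))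

  clash : ⊥
  clash = too-small (attained ∣σ∣≡M)

-- The barycentre and a simplex containing it

argmax : ∀ {n} (f : Fin (suc n) → ℕ) → ∃ λ j → ∀ l → f l ℕ.≤ f j
argmax {zero} f = zero , λ { zero → ℕ.≤-refl }
argmax {suc n} f with argmax (f ∘ suc)
... | j , max with ℕ.≤-total (f zero) (f (suc j))
... | inj₁ h = suc j , λ { zero → h ; (suc l) → max l }
... | inj₂ h = zero , λ { zero → ℕ.≤-refl ; (suc l) → ℕ.≤-trans (max l) h }

pos-part : ℤ → ℤ
pos-part (+ n) = + n
pos-part ℤ.-[1+ _ ] = + 0

pos-part-nonneg : ∀ i → + 0 ℤ.≤ pos-part i
pos-part-nonneg (+ n) = ℤ.+≤+ ℕ.z≤n
pos-part-nonneg ℤ.-[1+ _ ] = ≤-refl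

pos-part-difference : ∀ i → pos-part i - pos-part (- i) ≡ i
pos-part-difference (+ zero) = refl
pos-part-difference (+ suc n) = +-identityʳ (+ suc n)
pos-part-difference ℤ.-[1+ n ] = refl

pos-part-sum : ∀ i → pos-part i + pos-part (- i) ≡ + ∣ i ∣
pos-part-sum (+ zero) = refl
pos-part-sum (+ suc n) = +-identityʳ (+ suc n)
pos-part-sum ℤ.-[1+ n ] = refl

δ-nonneg : ∀ {n} (i j : Fin n) → + ∣ δ i j ∣ ≡ δ i j
δ-nonneg zero zero = refl
δ-nonneg zero (suc _) = refl
δ-nonneg (suc _) zero = refl
δ-nonneg (suc i) (suc j) = δ-nonneg i j

∣Σ∣≤Σ∣∣ : ∀ {n} (f : Fin n → ℤ) → + ∣ Σℤ f ∣ ℤ.≤ Σℤ (λ i → + ∣ f i ∣)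
∣Σ∣≤Σ∣∣ {zero} f = ≤-refl
∣Σ∣≤Σ∣∣ {suc n} f = ≤-trans (ℤ.+≤+ (∣i+j∣≤∣i∣+∣j∣ (f zero) (Σℤ (f ∘ suc))))
  (≤-trans (≤-reflexive (pos-+ ∣ f zero ∣ ∣ Σℤ (f ∘ suc) ∣)) (+-monoʳ-≤ (+ ∣ f zero ∣) (∣Σ∣≤Σ∣∣ (f ∘ suc))))

coeff-mass : ∀ {m s} {A : Mat m s} {x} (v : Vertex A x) → Σℤ (λ k → + ∣ coeff v k ∣) ℤ.≤ + 1
coeff-mass {s = s} (origin _) = subst (ℤ._≤ + 1) (sym (Σ-zero {s} (λ _ → refl))) (ℤ.+≤+ ℕ.z≤n)
coeff-mass (±column l ε unit _) = ≤-reflexive (trans (Σ-cong abs-term) (Σ-δ l (λ _ → + 1)))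
  where
  abs-term : ∀ k → + ∣ ε * δ l k ∣ ≡ δ l k * + 1
  abs-term k = trans (cong +_ (trans (abs-* ε (δ l k)) (trans (cong (ℕ._* ∣ δ l k ∣) unit) (ℕ.*-identityˡ ∣ δ l k ∣))))
    (trans (δ-nonneg l k) (sym (*-identityʳ (δ l k))))

theorem4p4 : ∀ {m s} (A : Mat m s) → Saturated A → HasRank A (s ∸ 1)
    → (a : Fin s → ℤ) → MinDep A a
    → (∀ b → MinDep A b → (b ≗ a) ⊎ (b ≗ (λ j → - a j)))
    → (+ 2) ∣ Σℤ a
    → ∃ (λ j → 1 < ∣ a j ∣)
    → ¬ RegUnimodTriang A
-- With a single column no other column is left to form a barycentre. That column is annihilated by
-- a nonzero integer, so it is zero; then 1 is in the kernel and hence a multiple of a.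
theorem4p4 {s = suc zero} A _ rank a min _ _ (zero , 1<∣a∣) _ = 1≢t*a (kernel-multiple A rank min (λ _ → + 1) one∈ker)
  where
  a≢0 : a zero ≢ + 0
  a≢0 h = ℕ.<⇒≢ (ℕ.<-trans (ℕ.s≤s ℕ.z≤n) 1<∣a∣) (sym (cong ∣_∣ h))
  one∈ker : InKer A (λ _ → + 1)
  one∈ker r = trans (+-identityʳ (A r zero * + 1)) (trans (*-identityʳ (A r zero)) (*-cancel-zero (a zero) a≢0
    (trans (*-comm (a zero) (A r zero)) (trans (sym (+-identityʳ (A r zero * a zero))) (proj₁ min r)))))
  1≢t*a : (∃ λ t → ∀ l → + 1 ≡ t * a l) → ⊥
  1≢t*a (t , h) = ℕ.<⇒≢ 1<∣a∣ (sym (ℕ.m*n≡1⇒n≡1 ∣ t ∣ ∣ a zero ∣ (trans (sym (abs-* t (a zero))) (sym (cong ∣_∣ (h zero))))))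
theorem4p4 {m} {suc (suc n)} A saturated rank a min _ even (j₀ , 1<∣aⱼ₀∣)
  (D , b , basis , t , T , lattice , covers , _ , volume , _) = from-signs (greedy-signs a′ (ℕ.<⇒≤ 1<M) ∣a′∣≤M)
  where
  j : Fin (suc (suc n))
  j = proj₁ (argmax (λ l → ∣ a l ∣))
  M : ℕ
  M = ∣ a j ∣
  ∣a∣≤M : ∀ l → ∣ a l ∣ ℕ.≤ M
  ∣a∣≤M = proj₂ (argmax (λ l → ∣ a l ∣))
  1<M : 1 ℕ.< M
  1<M = ℕ.≤-trans 1<∣aⱼ₀∣ (∣a∣≤M j₀)
  -- Normalises the dependency so that its entry at j becomes M.
  κ : ℤ
  κ = sgn (a j)
  ∣κ∣ : ∣ κ ∣ ≡ 1
  ∣κ∣ = unit (a j) (ℕ.<-trans (ℕ.s≤s ℕ.z≤n) 1<M)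
    where
    unit : ∀ i → 0 ℕ.< ∣ i ∣ → ∣ sgn i ∣ ≡ 1
    unit (+ suc _) _ = refl
    unit ℤ.-[1+ _ ] _ = refl
  a′ : Fin (suc n) → ℤ
  a′ l = κ * a (punchIn j l)
  ∣a′∣ : ∀ l → ∣ a′ l ∣ ≡ ∣ a (punchIn j l) ∣
  ∣a′∣ l = trans (abs-* κ (a (punchIn j l))) (trans (cong (ℕ._* ∣ a (punchIn j l) ∣) ∣κ∣) (ℕ.*-identityˡ ∣ a (punchIn j l) ∣))
  ∣a′∣≤M : ∀ l → ∣ a′ l ∣ ℕ.≤ M
  ∣a′∣≤M l = ℕ.≤-trans (ℕ.≤-reflexive (∣a′∣ l)) (∣a∣≤M (punchIn j l))
  kernel : ∀ c → InKer A c → ∃ λ t → ∀ l → c l ≡ t * a l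
  kernel = kernel-multiple A rank min

  from-signs : (∃ λ (η : Fin (suc n) → ℤ) → (∀ l → ∣ η l ∣ ≡ 1) × ∣ signedSum η a′ ∣ ℕ.≤ M ×
    (∣ signedSum η a′ ∣ ≡ M → ∃ λ m → η m * a′ m ≡ signedSum η a′)) → ⊥
  from-signs (η , unit , bounded , attained) = in-simplex (covers x x∈P)
    where
    w : Pt m
    w r = Σℤ (λ l → η l * A r (punchIn j l))
    x : Ptℚ m
    x r = recip n ℚ.* ι (w r)
    -- The signs are split into weights on columns and on their negatives; index j receives weight
    -- 0.
    p q η̂ : Fin (suc (suc n)) → ℤ
    p = insertAt (pos-part ∘ η) j (+ 0)
    q = insertAt (pos-part ∘ -_ ∘ η) j (+ 0)
    η̂ = insertAt η j (+ 0)

    by-punchIn : ∀ (P : Fin (suc (suc n)) → Set) → P j → (∀ l → P (punchIn j l)) → ∀ k → P k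
    by-punchIn P pj p k with j ≟ k
    ... | yes refl = pj
    ... | no j≢k = subst P (punchIn-punchOut j≢k) (p (punchOut j≢k))

    insertAt-nonneg : ∀ (f : Fin (suc n) → ℤ) → (∀ l → + 0 ℤ.≤ f l) → ∀ k → + 0 ℤ.≤ insertAt f j (+ 0) k
    insertAt-nonneg f h = by-punchIn (λ k → + 0 ℤ.≤ insertAt f j (+ 0) k)
      (≤-reflexive (sym (insertAt-lookup f j (+ 0)))) (λ l → subst (+ 0 ℤ.≤_) (sym (insertAt-punchIn f j (+ 0) l)) (h l))

    p-q : ∀ k → p k - q k ≡ η̂ k
    p-q = by-punchIn (λ k → p k - q k ≡ η̂ k)
      (trans (cong₂ _-_ (insertAt-lookup (pos-part ∘ η) j (+ 0)) (insertAt-lookup (pos-part ∘ -_ ∘ η) j (+ 0))) (sym (insertAt-lookup η j (+ 0))))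
      (λ l → trans (cong₂ _-_ (insertAt-punchIn (pos-part ∘ η) j (+ 0) l) (insertAt-punchIn (pos-part ∘ -_ ∘ η) j (+ 0) l))
        (trans (pos-part-difference (η l)) (sym (insertAt-punchIn η j (+ 0) l))))

    Σ-η̂ : ∀ r → Σℤ (λ k → η̂ k * A r k) ≡ w r
    Σ-η̂ r = trans (Σ-punch j (λ k → η̂ k * A r k)) (trans (cong₂ _+_
      (trans (cong (_* A r j) (insertAt-lookup η j (+ 0))) (*-zeroˡ (A r j)))
      (Σ-cong (λ l → cong (_* A r (punchIn j l)) (insertAt-punchIn η j (+ 0) l)))) (+-identityˡ (w r)))

    total : Σℤ (λ k → p k + q k) ≡ + suc n
    total = trans (Σ-punch j (λ k → p k + q k)) (trans (cong₂ _+_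
      (cong₂ _+_ (insertAt-lookup (pos-part ∘ η) j (+ 0)) (insertAt-lookup (pos-part ∘ -_ ∘ η) j (+ 0)))
      (trans (Σ-cong (λ l → trans (cong₂ _+_ (insertAt-punchIn (pos-part ∘ η) j (+ 0) l) (insertAt-punchIn (pos-part ∘ -_ ∘ η) j (+ 0) l))
        (trans (pos-part-sum (η l)) (cong +_ (unit l))))) (trans (Σ-const (suc n) (+ 1)) (*-identityʳ (+ suc n)))))
      (+-identityˡ (+ suc n)))

    x∈P : InConv (cols± A) x
    x∈P = inConv-cols± A p q n w (insertAt-nonneg _ (λ l → pos-part-nonneg (η l))) (insertAt-nonneg _ (λ l → pos-part-nonneg (- η l))) total
      (λ r → trans (Σ-cong (λ k → cong (_* A r k) (p-q k))) (Σ-η̂ r))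

    in-simplex : (∃ λ k → InConv (T k) x) → ⊥
    in-simplex (k , x∈Tₖ) = compare (integer-weights (T k) n w (λ _ → refl) x∈Tₖ) unit-index
      where
      open UnimodularSimplex A (proj₁ min) kernel even 1<M b basis (T k) (λ v → classify saturated (T k v) (lattice k v)) (volume k)
      vertex : ∀ v → Vertex A (T k v)
      vertex v = classify saturated (T k v) (lattice k v)

      compare : (∃ λ d → ∃ λ (z : Fin (suc D) → ℤ) → (∀ v → + 0 ℤ.≤ z v) × Σℤ z ≡ + suc d ×
          (∀ r → + suc n * Σℤ (λ v → z v * T k v r) ≡ + suc d * w r)) →
        (∃ λ i → ∣ a i ∣ ≡ 1 × (∀ v → C v i ≡ + 0)) → ⊥
      compare (d , z , z≥0 , Σz , position) (i , ∣aᵢ∣ , unused) = conclude (kernel c c∈ker)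
        where
        -- Scaled by n + 1 and d + 1 respectively, μ and η̂ are preimages under A of the same
        -- multiple of the barycentre, so their difference c is in the kernel.
        μ c : Fin (suc (suc n)) → ℤ
        μ l = Σℤ (λ v → z v * C v l)
        c l = + suc n * μ l + (- + suc d) * η̂ l

        c∈ker : InKer A c
        c∈ker r = trans (Σ-cong (λ l → lem₁ (A r l) (+ suc n) (μ l) (- + suc d) (η̂ l)))
          (trans (Σ-linear (+ suc n) (- + suc d) (λ l → μ l * A r l) (λ l → η̂ l * A r l))
          (trans (cong₂ (λ u v → + suc n * u + (- + suc d) * v)
            (trans (sym (Σ-combine z C columns r)) (Σ-cong (λ v → cong (_*_ (z v)) (coeff-sum (vertex v) r)))) (Σ-η̂ r))
          (trans (cong (_+ (- + suc d) * w r) (position r)) (lem₂ (+ suc d) (w r)))))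
          where
          lem₁ : ∀ a N u D e → a * (N * u + D * e) ≡ N * (u * a) + D * (e * a)
          lem₁ = solve-∀
          lem₂ : ∀ D w → D * w + (- D) * w ≡ + 0
          lem₂ = solve-∀

        -- Triangle inequality: each vertex has coefficients of total absolute value at most 1.
        mass : Σℤ (λ l → + ∣ μ l ∣) ℤ.≤ + suc d
        mass = ≤-trans (Σ-mono-≤ (λ l → ≤-trans (∣Σ∣≤Σ∣∣ (λ v → z v * C v l)) (≤-reflexive (Σ-cong (λ v → abs-weight v l)))))
          (≤-trans (≤-reflexive (trans (Σ-swap (λ l v → z v * + ∣ C v l ∣)) (Σ-cong (λ v → Σ-*ˡ (z v) (λ l → + ∣ C v l ∣)))))
          (≤-trans (Σ-mono-≤ (λ v → *-monoˡ-≤-nonNeg (z v) ⦃ ℤ.nonNegative (z≥0 v) ⦄ (coeff-mass (vertex v))))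
          (≤-reflexive (trans (Σ-cong (λ v → *-identityʳ (z v))) Σz))))
          where
          abs-weight : ∀ v l → + ∣ z v * C v l ∣ ≡ z v * + ∣ C v l ∣
          abs-weight v l = trans (cong +_ (abs-* (z v) (C v l))) (trans (pos-* ∣ z v ∣ ∣ C v l ∣) (cong (_* + ∣ C v l ∣) (0≤i⇒+∣i∣≡i (z≥0 v))))

        j≢i : j ≢ i
        j≢i refl = ℕ.<-irrefl (sym ∣aᵢ∣) 1<M
        i′ : Fin (suc n)
        i′ = punchOut j≢i

        conclude : (∃ λ t → ∀ l → c l ≡ t * a l) → ⊥
        conclude (t , ht) = Clash.clash {n} {M} {d} 1<M a′ η unit bounded attained (μ ∘ punchIn j) (μ j) (t * κ) rel relⱼ
          (subst (ℤ._≤ + suc d) (trans (Σ-punch j (λ l → + ∣ μ l ∣)) (+-comm (+ ∣ μ j ∣) (Σℤ (λ l → + ∣ μ (punchIn j l) ∣)))) mass)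
          i′ (trans (∣a′∣ i′) (trans (cong (λ l → ∣ a l ∣) (punchIn-punchOut j≢i)) ∣aᵢ∣))
          (trans (cong μ (punchIn-punchOut j≢i)) (Σ-zero (λ v → trans (cong (_*_ (z v)) (unused v)) (*-zeroʳ (z v)))))
          where
          solved : ∀ l → + suc n * μ l ≡ + suc d * η̂ l + t * a l
          solved l = trans (lem (+ suc n * μ l) (+ suc d) (η̂ l)) (cong (_+_ (+ suc d * η̂ l)) (ht l))
            where
            lem : ∀ x D e → x ≡ D * e + (x + (- D) * e)
            lem = solve-∀
          -- As κ² = 1, the normalising sign can be moved into the multiplier t.
          unflip : ∀ l → t * a l ≡ t * κ * (κ * a l)
          unflip l = sym (trans (lem t κ (a l)) (trans (cong (_* (t * a l)) (unit² κ ∣κ∣)) (*-identityˡ (t * a l))))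
            where
            lem : ∀ t k a → t * k * (k * a) ≡ k * k * (t * a)
            lem = solve-∀
          rel : ∀ l → + suc n * μ (punchIn j l) ≡ + suc d * η l + t * κ * a′ l
          rel l = trans (solved (punchIn j l)) (cong₂ (λ x y → + suc d * x + y) (insertAt-punchIn η j (+ 0) l) (unflip (punchIn j l)))
          relⱼ : + suc n * μ j ≡ t * κ * + M
          relⱼ = trans (solved j) (trans (cong₂ (λ x y → + suc d * x + y) (insertAt-lookup η j (+ 0))
              (trans (unflip j) (cong (_*_ (t * κ)) (sgn*i≡∣i∣ (a j)))))
            (trans (cong (_+ t * κ * + M) (*-zeroʳ (+ suc d))) (+-identityˡ (t * κ * + M))))
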